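{- Let $(\pi,V)\in\mathrm{VHC}(\mathrm{Av}_n(312))$ and $(P,Q)=\widehat\Lambda_n(\pi,V)$. If $P\not\leq_T Q$, then with $\tau=\mathrm{swr}(\pi)$ and $W=\{\mathrm{swr}(\mathrm{nw}^{ -1}(A)):A\in V\}$, there is no valid hook configuration on $\tau$ whose set of northeast endpoints is $W$.
   Context: For $\pi\in S_n$ with plot $\{(i,\pi_i)\}$: $(i,\pi_i)$ is a descent top if $i<n$, $\pi_i>\pi_{i+1}$. A hook from $(i,\pi_i)$ to $(j,\pi_j)$ ($i<j$, $\pi_i<\pi_j$) is the vertical segment from $(i,\pi_i)$ to $(i,\pi_j)$ then horizontal to $(j,\pi_j)$ (southwest/northeast endpoints). A valid hook configuration (VHC) is a set of hooks with (i) southwest endpoints exactly the descent tops; (ii) for each hook from $(i,\pi_i)$ to $(j,\pi_j)$ no $k$ with $i<k<j$, $\pi_k>\pi_j$; (iii) hooks meeting only at endpoints; it is written $(\pi,V)$ with $V$ its set of northeast endpoints. $\mathrm{Av}_n(312)$: permutations with no $a<b<c$, $\pi_b<\pi_c<\pi_a$. For $i\in[n]$ let $(m,\pi_m)$ be the point with $\pi_m=i$, $B$ (resp. $T$) the subsequence of $\pi_1\cdots\pi_{m-1}$ of entries $<i$ (resp. $>i$); $\mathrm{swr}_i(\pi)=T\,B\,\pi_m\cdots\pi_n$ and $\mathrm{swr}=\mathrm{swr}_1\circ\cdots\circ\mathrm{swr}_n$. The image $\mathrm{swr}(p)$ of a point $p$ of height $h$ is the point of height $h$ in $\mathrm{swr}(\pi)$.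 A left-to-right maximum is a point with no strictly higher point to its left. $\mathrm{nw}(i,\pi_i)$ is the leftmost left-to-right maximum $(j,\pi_j)$ with $j\leq i$, $\pi_j\geq\pi_i$; for a left-to-right maximum $A$, $\mathrm{nw}^{ -1}(A)$ is the rightmost point $q$ with $\mathrm{nw}(q)=A$. Motzkin paths: words in $\{U,D,E\}$ with equally many $U$'s and $D$'s, every prefix having at least as many $U$'s as $D$'s. The class of $P$ is its subsequence of $U$'s and $E$'s. Writing $P=X_1D^{\gamma_1}\cdots X_\ell D^{\gamma_\ell}$ ($X_i\in\{U,E\}$), $\mathrm{lng}_i(P)$ is the length of the shortest consecutive substring starting at $X_i$ that is a Motzkin path. $P\leq_T Q$ iff $P,Q$ have the same class and $\mathrm{lng}_i(P)\le\mathrm{lng}_i(Q)$ for all $i$. $\widehat\Lambda_n(\pi,V)$: let $\mathfrak R_0,\ldots,\mathfrak R_\ell$ be the left-to-right maxima of $\pi$ from right to left ($\mathfrak R_0=(n,n)$), $\mathfrak R_{\ell+1}=(0,0)$; for $i\in[\ell]$, $\gamma_i$ = number of points strictly between $\mathfrak R_i$ and $\mathfrak R_{i-1}$ horizontally, $\gamma'_i$ = number of points strictly above $\mathfrak R_{i+1}$ and strictly below $\mathfrak R_i$, $X_i=U$ if $\mathfrak R_{i-1}\in V$ else $E$. Then $\widehat\Lambda_n(\pi,V)=(X_1D^{\gamma_1}\cdots X_\ell D^{\gamma_\ell},\,X_1D^{\gamma'_1}\cdots X_\ell D^{\gamma'_\ell})$. -}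

module Defs where

open import Data.Nat using (ℕ; zero; suc; _∸_; _≤_; _<_; _<ᵇ_; _≡ᵇ_)
open import Data.Bool using (Bool; true; false; if_then_else_; _∨_)
open import Data.List using (List; []; _∷_; _++_; length; map; upTo; replicate; reverse; take; foldr)
open import Data.List.Membership.Propositional using (_∈_)
open import Data.List.Relation.Binary.Permutation.Propositional using (_↭_)
open import Data.Product using (Σ; _×_; _,_; proj₁; proj₂)
open import Data.Maybe using (Maybe; just; nothing)
open import Relation.Nullary using (¬_)
open import Relation.Binary.PropositionalEquality using (_≡_; _≢_)

-- Permutations as one-line notation  π = π₁ π₂ … πₙ  (a list of ℕ).
-- Points of the plot are identified with their (1-based) positions.

IsPerm : ℕ → List ℕ → Set
IsPerm n π = π ↭ map suc (upTo n)

-- πᵢ (1-based; 0 outside the range, never used there)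
at : List ℕ → ℕ → ℕ
at []       _             = 0
at (x ∷ xs) zero          = 0
at (x ∷ xs) (suc zero)    = x
at (x ∷ xs) (suc (suc k)) = at xs (suc k)

InRange : List ℕ → ℕ → Set
InRange π i = 1 ≤ i × i ≤ length π

Av312 : List ℕ → Set
Av312 π = ∀ a b c → 1 ≤ a → a < b → b < c → c ≤ length π →
          ¬ (at π b < at π c × at π c < at π a)

-- Valid hook configurations.  A hook is a pair (i , j) of positions:
-- from (i,πᵢ) (southwest endpoint) to (j,πⱼ) (northeast endpoint).

DescentTop : List ℕ → ℕ → Set
DescentTop π i = 1 ≤ i × i < length π × at π (suc i) < at π i

Hook : Set
Hook = ℕ × ℕ

-- A point (x , y) given in doubled coordinates (so that points of the
-- real plane on two axis-parallel segments with integer endpoints can be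
-- detected: any overlap of positive length contains a half-integer point).
-- OnHook π h (x , y): the point (x/2 , y/2) lies on the hook h.
OnHook : List ℕ → Hook → ℕ × ℕ → Set
OnHook π (i , j) (x , y) =
  (x ≡ 2 Data.Nat.* i × 2 Data.Nat.* at π i ≤ y × y ≤ 2 Data.Nat.* at π j)
  Data.Sum.⊎
  (y ≡ 2 Data.Nat.* at π j × 2 Data.Nat.* i ≤ x × x ≤ 2 Data.Nat.* j)
  where import Data.Sum ; import Data.Nat

IsEndpoint : List ℕ → Hook → ℕ × ℕ → Set
IsEndpoint π (i , j) (x , y) =
  ((x ≡ 2 Data.Nat.* i) × (y ≡ 2 Data.Nat.* at π i))
  Data.Sum.⊎
  ((x ≡ 2 Data.Nat.* j) × (y ≡ 2 Data.Nat.* at π j))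
  where import Data.Sum ; import Data.Nat

record IsVHC (π : List ℕ) (H : List Hook) : Set where
  field
    hook-wf   : ∀ i j → (i , j) ∈ H →
                1 ≤ i × i < j × j ≤ length π × at π i < at π j
    sw-descent : ∀ i → DescentTop π i → Σ ℕ (λ j → (i , j) ∈ H)
    descent-sw : ∀ i j → (i , j) ∈ H → DescentTop π i
    no-higher : ∀ i j k → (i , j) ∈ H → i < k → k < j → ¬ (at π j < at π k)
    meet-ends : ∀ h h' → h ∈ H → h' ∈ H → h ≢ h' → ∀ p →
                OnHook π h p → OnHook π h' p →
                IsEndpoint π h p × IsEndpoint π h' p

NEEndpointsAre : List Hook → (ℕ → Set) → Set
NEEndpointsAre H V = ∀ p → (p ∈ map proj₂ H → V p) × (V p → p ∈ map proj₂ H)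

HasVHC : List ℕ → List ℕ → Set
HasVHC π V = Σ (List Hook) (λ H → IsVHC π H × NEEndpointsAre H (λ p → p ∈ V))

splitV : ℕ → List ℕ → List ℕ × List ℕ
splitV i [] = [] , []
splitV i (x ∷ xs) with x ≡ᵇ i
... | true  = [] , x ∷ xs
... | false = let r = splitV i xs in (x ∷ proj₁ r) , proj₂ r

filterB : (ℕ → Bool) → List ℕ → List ℕ
filterB p [] = []
filterB p (x ∷ xs) = if p x then x ∷ filterB p xs else filterB p xs

swrI : ℕ → List ℕ → List ℕ
swrI i σ = let r = splitV i σ in
  filterB (λ x → i <ᵇ x) (proj₁ r) ++ filterB (λ x → x <ᵇ i) (proj₁ r) ++ proj₂ r

swr : List ℕ → List ℕ
swr π = foldr swrI π (map suc (upTo (length π)))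

LRMax : List ℕ → ℕ → Set
LRMax π j = InRange π j × (∀ k → 1 ≤ k → k < j → at π k < at π j)

IsNw : List ℕ → ℕ → ℕ → Set
IsNw π i j = InRange π i × LRMax π j × j ≤ i × at π i ≤ at π j ×
  (∀ j' → LRMax π j' → j' ≤ i → at π i ≤ at π j' → j ≤ j')

IsNwInv : List ℕ → ℕ → ℕ → Set
IsNwInv π A q = IsNw π q A × (∀ q' → q < q' → q' ≤ length π → ¬ IsNw π q' A)

InW : List ℕ → List ℕ → ℕ → Set
InW π V w = Σ ℕ λ A → A ∈ V × Σ ℕ λ q → IsNwInv π A q ×
            InRange (swr π) w × at (swr π) w ≡ at π q

data Step : Set where
  U D E : Step

countU countD : List Step → ℕ
countU [] = 0
countU (U ∷ w) = suc (countU w)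
countU (_ ∷ w) = countU w
countD [] = 0
countD (D ∷ w) = suc (countD w)
countD (_ ∷ w) = countD w

Motzkin : List Step → Set
Motzkin w = countU w ≡ countD w × (∀ k → countD (take k w) ≤ countU (take k w))

cls : List Step → List Step
cls [] = []
cls (D ∷ w) = cls w
cls (x ∷ w) = x ∷ cls w

-- suffix starting at X_i (1-based index among the non-D letters)
fromX : ℕ → List Step → Maybe (List Step)
fromX i [] = nothing
fromX i (D ∷ w) = fromX i w
fromX zero (x ∷ w) = nothing
fromX (suc zero) (x ∷ w) = just (x ∷ w)
fromX (suc (suc k)) (x ∷ w) = fromX (suc k) w

IsLng : List Step → ℕ → ℕ → Set
IsLng P i l = Σ (List Step) λ s → fromX i P ≡ just s × 1 ≤ l × l ≤ length s ×
  Motzkin (take l s) × (∀ l' → 1 ≤ l' → l' < l → ¬ Motzkin (take l' s))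

_≤T_ : List Step → List Step → Set
P ≤T Q = cls P ≡ cls Q × (∀ i l l' → IsLng P i l → IsLng Q i l' → l ≤ l')

lrGo : ℕ → ℕ → List ℕ → List ℕ
lrGo m i [] = []
lrGo m i (x ∷ xs) = if m <ᵇ x then i ∷ lrGo x (suc i) xs else lrGo m (suc i) xs

lrMaxima : List ℕ → List ℕ
lrMaxima π = lrGo 0 1 π

elemB : ℕ → List ℕ → Bool
elemB a [] = false
elemB a (x ∷ xs) = (a ≡ᵇ x) ∨ elemB a xs

Xof : List ℕ → ℕ → Step
Xof V r = if elemB r V then U else E

-- prev = R_{i-1}, list = R_i, R_{i+1}, …, R_ℓ (positions)
buildP : List ℕ → ℕ → List ℕ → List Step
buildP V prev [] = []
buildP V prev (r ∷ rs) = Xof V prev ∷ (replicate (prev ∸ r ∸ 1) D ++ buildP V r rs)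

buildQ : List ℕ → List ℕ → ℕ → List ℕ → List Step
buildQ π V prev [] = []
buildQ π V prev (r ∷ []) = Xof V prev ∷ replicate (at π r ∸ 0 ∸ 1) D
buildQ π V prev (r ∷ r' ∷ rs) =
  Xof V prev ∷ (replicate (at π r ∸ at π r' ∸ 1) D ++ buildQ π V r (r' ∷ rs))

ΛP ΛQ : List ℕ → List ℕ → List Step
ΛP π V with reverse (lrMaxima π)
... | [] = []
... | r₀ ∷ rs = buildP V r₀ rs
ΛQ π V with reverse (lrMaxima π)
... | [] = []
... | r₀ ∷ rs = buildQ π V r₀ rs

module Submission where

-- Let R₀ > R₁ > … > R_ℓ be the left-to-right maxima of π read from the right and w_j = π(R_{j+1}) + 1,
-- the height of nw⁻¹(R_j).  For values a < b, a precedes b in swr π iff b comes after a and after every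
-- value between a and b in π; hence a descent top of swr π is at the height of a descent top of π.
-- Suppose swr π has a configuration with northeast endpoints W, and that a balanced prefix of Q at X_i
-- uses the blocks X_i, …, X_m.  If the blocks of P up to X_m contain too few D's, then by counting some
-- value y with π(R_{m+1}) < y < w_{i-1} lies to the right of R_{i-1} in π.  Take the largest such y and
-- let π(R_{s+1}) < y < π(R_s).  As y comes after w_{i-1}, …, w_{s-1} in π, the hooks ending there start at
-- heights between y and w_{i-1}; the points following these heights in π are distinct, are not
-- left-to-right maxima, and lie between R_s and R_{i-1}.  So P is balanced by the end of block X_s, s ≤ m.

open import Defs
open import Data.Nat using (ℕ; zero; suc; _+_; _*_; _∸_; _⊓_; _≤_; _<_; z≤n; s≤s; _≤?_; _<?_; _≟_; _<ᵇ_; _≡ᵇ_)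
open import Data.Nat.Properties
open import Data.Bool using (Bool; true; false; T; if_then_else_)
open import Data.Unit using (tt)
open import Data.Maybe using (just)
open import Data.Maybe.Properties using (just-injective)
open import Data.Fin using (Fin; zero; suc; fromℕ<)
open import Data.Fin.Properties using (injective⇒≤; fromℕ<-injective)
open import Data.List using (List; []; _∷_; _++_; length; map; upTo; applyUpTo; replicate; take; reverse; foldl; foldr; lookup)
open import Data.List.Properties using (take-take; length-++; length-replicate; length-map; length-upTo; length-applyUpTo; ++-identityʳ)
open import Data.List.Membership.Propositional using (_∈_; _∉_)
open import Data.List.Membership.Propositional.Properties using (∈-++⁺ˡ; ∈-++⁺ʳ; ∈-++⁻; ∈-map⁺; ∈-map⁻; ∈-upTo⁺; ∈-upTo⁻; ∈-lookup)
open import Data.List.Relation.Unary.Any using (here; there)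
open import Data.List.Relation.Unary.All as All using (All; []; _∷_)
import Data.List.Relation.Unary.All.Properties as All
open import Data.List.Relation.Unary.AllPairs using ([]; _∷_)
open import Data.List.Relation.Unary.Unique.Propositional using (Unique)
import Data.List.Relation.Unary.Unique.Propositional.Properties as Unique
open import Data.List.Relation.Binary.Permutation.Propositional using (_↭_; ↭-sym; ↭-trans; ↭-refl; prep; ↭⇒↭ₛ)
open import Data.List.Relation.Binary.Permutation.Propositional.Properties using (∈-resp-↭; ↭-length; ++⁺ʳ; shift; ++-assoc)
import Data.List.Relation.Binary.Permutation.Setoid.Properties as ↭ₛ
open import Data.Product using (Σ; ∃; _×_; _,_; proj₁; proj₂; map₂)
open import Data.Sum using (_⊎_; inj₁; inj₂)
open import Data.Empty using (⊥; ⊥-elim)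
open import Function using (_∘_; flip)
open import Relation.Nullary using (¬_; yes; no; _×-dec_)
open import Relation.Unary using (Decidable)
open import Relation.Binary.Definitions using (tri<; tri≈; tri>)
open import Relation.Binary.PropositionalEquality

-- Words in blocks

mark : Bool → Step
mark b = if b then U else E

-- Letters and run lengths are functions on ℕ, so that the suffix starting at a later letter is
-- again a `word`, with shifted arguments.
word : (ℕ → Bool) → (ℕ → ℕ) → ℕ → List Step
word B γ zero    = []
word B γ (suc L) = mark (B 0) ∷ (replicate (γ 0) D ++ word (B ∘ suc) (γ ∘ suc) L)

count : (ℕ → Bool) → ℕ → ℕ
count B zero    = 0
count B (suc m) = (if B 0 then 1 else 0) + count (B ∘ suc) m

total : (ℕ → ℕ) → ℕ → ℕ
total γ zero    = 0
total γ (suc m) = γ 0 + total (γ ∘ suc) m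

cls-D : ∀ g w → cls (replicate g D ++ w) ≡ cls w
cls-D zero    w = refl
cls-D (suc g) w = cls-D g w

cls-word : ∀ B γ γ′ L → cls (word B γ L) ≡ cls (word B γ′ L)
cls-word B γ γ′ zero = refl
cls-word B γ γ′ (suc L)
  with B 0 | trans (cls-D (γ 0) _) (trans (cls-word (B ∘ suc) (γ ∘ suc) (γ′ ∘ suc) L) (sym (cls-D (γ′ 0) _)))
... | true  | eq = cong (U ∷_) eq
... | false | eq = cong (E ∷_) eq

fromX-D : ∀ i g w → fromX i (replicate g D ++ w) ≡ fromX i w
fromX-D i zero    w = refl
fromX-D i (suc g) w = fromX-D i g w

fromX-mark : ∀ b i w → fromX (suc (suc i)) (mark b ∷ w) ≡ fromX (suc i) w
fromX-mark true  i w = refl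
fromX-mark false i w = refl

fromX-one : ∀ b w → fromX 1 (mark b ∷ w) ≡ just (mark b ∷ w)
fromX-one true  w = refl
fromX-one false w = refl

fromX-word : ∀ i B γ L {s} → fromX i (word B γ L) ≡ just s →
  ∃ λ k → i ≡ suc k × k < L × s ≡ word (B ∘ (k +_)) (γ ∘ (k +_)) (L ∸ k)
fromX-word i B γ zero ()
fromX-word zero B γ (suc L) eq with B 0
fromX-word zero B γ (suc L) () | true
fromX-word zero B γ (suc L) () | false
fromX-word (suc zero) B γ (suc L) eq =
  0 , refl , s≤s z≤n , sym (just-injective (trans (sym (fromX-one (B 0) _)) eq))
fromX-word (suc (suc i)) B γ (suc L) {s} eq
  with k , refl , k<L , s≡ ← fromX-word (suc i) (B ∘ suc) (γ ∘ suc) L (trans (sym (fromX-D (suc i) (γ 0) _)) (trans (sym (fromX-mark (B 0) i _)) eq))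
  = suc k , refl , s≤s k<L , s≡

-- A cut either falls within the leading run of D's or covers that run; the resulting counts are
-- kept as equations for both prefix lemmas.
data TakeDs (g : ℕ) (w : List Step) (t : ℕ) : Set where
  inside : t ≤ g → countU (take t (replicate g D ++ w)) ≡ 0 →
           countD (take t (replicate g D ++ w)) ≡ t → TakeDs g w t
  beyond : ∀ t′ → t ≡ g + t′ →
           countU (take t (replicate g D ++ w)) ≡ countU (take t′ w) →
           countD (take t (replicate g D ++ w)) ≡ g + countD (take t′ w) → TakeDs g w t

takeDs : ∀ g w t → TakeDs g w t
takeDs g       w zero    = inside z≤n refl refl
takeDs zero    w (suc t) = beyond (suc t) refl refl refl
takeDs (suc g) w (suc t) with takeDs g w t
... | inside t≤g u d      = inside (s≤s t≤g) u (cong suc d)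
... | beyond t′ eq u d = beyond t′ (cong suc eq) u (cong suc d)

countU-mark : ∀ b w → countU (mark b ∷ w) ≡ (if b then 1 else 0) + countU w
countU-mark true  w = refl
countU-mark false w = refl

countD-mark : ∀ b w → countD (mark b ∷ w) ≡ countD w
countD-mark true  w = refl
countD-mark false w = refl

+-swap : ∀ a b c → a + (b + c) ≡ b + (a + c)
+-swap a b c = trans (sym (+-assoc a b c)) (trans (cong (_+ c) (+-comm a b)) (+-assoc b a c))

prefix-blocks : ∀ B γ L l → l ≤ length (word B γ L) → ∃ λ m → m ≤ L ×
  countU (take l (word B γ L)) ≡ count B m ×
  l ≡ m + countD (take l (word B γ L)) ×
  countD (take l (word B γ L)) ≤ total γ m
prefix-blocks B γ L       zero    _       = 0 , z≤n , refl , refl , z≤n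
prefix-blocks B γ (suc L) (suc l) (s≤s l≤)
  with w ← word (B ∘ suc) (γ ∘ suc) L in weq | takeDs (γ 0) w l
... | inside l≤γ u d = 1 , s≤s z≤n
    , trans (countU-mark (B 0) _) (cong (_ +_) u)
    , cong suc (sym (trans (countD-mark (B 0) _) d))
    , ≤-trans (≤-reflexive (trans (countD-mark (B 0) _) d)) (≤-trans l≤γ (m≤m+n _ _))
... | beyond t l≡ u d
  with m , m≤L , um , lm , dm ← prefix-blocks (B ∘ suc) (γ ∘ suc) L t
       (subst (λ v → t ≤ length v) (sym weq) (+-cancelˡ-≤ (γ 0) t (length w)
         (subst₂ _≤_ l≡ (trans (length-++ (replicate (γ 0) D)) (cong (_+ length w) (length-replicate (γ 0)))) l≤)))
  rewrite weq
  = suc m , s≤s m≤L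
  , trans (countU-mark (B 0) _) (cong (_ +_) (trans u um))
  , cong suc (begin
      l                              ≡⟨ l≡ ⟩
      γ 0 + t                        ≡⟨ cong (γ 0 +_) lm ⟩
      γ 0 + (m + countD (take t w))  ≡⟨ +-swap (γ 0) m _ ⟩
      m + (γ 0 + countD (take t w))  ≡⟨ cong (m +_) (sym (trans (countD-mark (B 0) _) d)) ⟩
      m + countD (take (suc l) (mark (B 0) ∷ (replicate (γ 0) D ++ w))) ∎)
  , ≤-trans (≤-reflexive (trans (countD-mark (B 0) _) d)) (+-monoʳ-≤ (γ 0) dm)
  where open ≡-Reasoning

-- The converse estimate: a cut within the first `m` blocks meets at most `m` letters other than D.
prefix-counts : ∀ B γ L m t → m ≤ L → t ≤ m + total γ m →
  countU (take t (word B γ L)) ≤ count B m × t ≤ m + countD (take t (word B γ L))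
prefix-counts B γ L       m       zero    _ _ = z≤n , z≤n
prefix-counts B γ (suc L) (suc m) (suc t) (s≤s m≤L) (s≤s t≤)
  with w ← word (B ∘ suc) (γ ∘ suc) L in weq | takeDs (γ 0) w t
... | inside t≤γ u d =
    ≤-trans (≤-reflexive (trans (countU-mark (B 0) _) (cong (_ +_) u))) (+-monoʳ-≤ _ z≤n)
  , s≤s (≤-trans (m≤n+m t m) (≤-reflexive (cong (m +_) (sym (trans (countD-mark (B 0) _) d)))))
... | beyond t′ t≡ u d
  with um , dm ← prefix-counts (B ∘ suc) (γ ∘ suc) L m t′ m≤L
       (+-cancelˡ-≤ (γ 0) t′ _ (≤-trans (≤-reflexive (sym t≡)) (≤-trans t≤ (≤-reflexive (+-swap m (γ 0) _)))))
  rewrite weq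
  = ≤-trans (≤-reflexive (trans (countU-mark (B 0) _) (cong (_ +_) u))) (+-monoʳ-≤ _ um)
  , s≤s (begin
      t                              ≡⟨ t≡ ⟩
      γ 0 + t′                       ≤⟨ +-monoʳ-≤ (γ 0) dm ⟩
      γ 0 + (m + countD (take t′ w)) ≡⟨ +-swap (γ 0) m _ ⟩
      m + (γ 0 + countD (take t′ w)) ≡⟨ cong (m +_) (sym (trans (countD-mark (B 0) _) d)) ⟩
      m + countD (take (suc t) (mark (B 0) ∷ (replicate (γ 0) D ++ w))) ∎)
  where open ≤-Reasoning

-- A prefix shorter than `l` inherits the Motzkin prefix condition, so having no more U's than D's
-- would already make it a Motzkin path, against the minimality of `l`.
minimal-motzkin : ∀ s l t → Motzkin (take l s) → (∀ l′ → 1 ≤ l′ → l′ < l → ¬ Motzkin (take l′ s)) →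
  1 ≤ t → countU (take t s) ≤ countD (take t s) → l ≤ t
minimal-motzkin s l t (_ , prefixes) minimal 1≤t U≤D with l ≤? t
... | yes l≤t = l≤t
... | no  l≰t = ⊥-elim (minimal t 1≤t t<l (≤-antisym U≤D (prefixes′ t ≤-refl) , λ k →
        subst (λ w → countD w ≤ countU w) (sym (take-take k t s)) (prefixes′ (k ⊓ t) (m⊓n≤n k t))))
  where
  t<l : t < l
  t<l = ≰⇒> l≰t
  prefixes′ : ∀ k → k ≤ t → countD (take k s) ≤ countU (take k s)
  prefixes′ k k≤t = subst (λ w → countD w ≤ countU w)
    (trans (take-take k l s) (cong (λ j → take j s) (m≤n⇒m⊓n≡m (≤-trans k≤t (<⇒≤ t<l))))) (prefixes k)

count-mono : ∀ B {m m′} → m ≤ m′ → count B m ≤ count B m′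
count-mono B z≤n     = z≤n
count-mono B (s≤s p) = +-monoʳ-≤ _ (count-mono (B ∘ suc) p)

-- With P and Q given by the same letters, a balanced prefix of Q made of m blocks has
-- length m + count B m, and P is balanced that early as soon as its first s ≤ m blocks contain
-- enough D's.
≤T-words : ∀ B γ γ′ L →
  (∀ k m → k < L → m ≤ L ∸ k → 1 ≤ m → count (B ∘ (k +_)) m ≤ total (γ′ ∘ (k +_)) m →
    ∃ λ s → 1 ≤ s × s ≤ m × count (B ∘ (k +_)) s ≤ total (γ ∘ (k +_)) s) →
  word B γ L ≤T word B γ′ L
≤T-words B γ γ′ L core = cls-word B γ γ′ L , lng
  where
  lng : ∀ i l l′ → IsLng (word B γ L) i l → IsLng (word B γ′ L) i l′ → l ≤ l′
  lng i l l′ (p , p≡ , _ , _ , Mp , minp) (q , q≡ , 1≤l′ , l′≤q , (bal , _) , _)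
    with k , refl , k<L , refl ← fromX-word i B γ L p≡ | k , refl , _ , refl ← fromX-word i B γ′ L q≡
    with prefix-blocks (B ∘ (k +_)) (γ′ ∘ (k +_)) (L ∸ k) l′ l′≤q
  ... | zero , m≤ , u≡ , l′≡ , d≤ = ⊥-elim (n≮0 (≤-trans 1≤l′ (≤-trans (≤-reflexive l′≡) d≤)))
  ... | suc m , m≤ , u≡ , l′≡ , d≤
    with s , 1≤s , s≤m , cnt ← core k (suc m) k<L m≤ (s≤s z≤n)
           (≤-trans (≤-reflexive (trans (sym u≡) bal)) d≤)
    -- A cut of this length stays within the first `s` blocks of `P`, so the prefix has at most
    -- `count … s` U's and at least that many D's.
    with Us , Ds ← prefix-counts (B ∘ (k +_)) (γ ∘ (k +_)) (L ∸ k) s (s + count (B ∘ (k +_)) s)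
                     (≤-trans s≤m m≤) (+-monoʳ-≤ s cnt)
    = ≤-trans (minimal-motzkin _ l (s + count (B ∘ (k +_)) s) Mp minp (≤-trans 1≤s (m≤m+n s _))
                (≤-trans Us (+-cancelˡ-≤ s _ _ Ds)))
        (≤-trans (+-mono-≤ s≤m (count-mono (B ∘ (k +_)) s≤m))
          (≤-reflexive (trans (cong (suc m +_) (trans (sym u≡) bal)) (sym l′≡))))

-- The order of values in swr π

-- Phrased by membership instead of positions, so that it passes through `++` and `filterB`;
-- positions return with `index`.
data Before : List ℕ → ℕ → ℕ → Set where
  here  : ∀ {a b xs} → b ∈ xs → Before (a ∷ xs) a b
  there : ∀ {x a b xs} → Before xs a b → Before (x ∷ xs) a b

Before-∈ˡ : ∀ {xs a b} → Before xs a b → a ∈ xs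
Before-∈ˡ (here _)  = here refl
Before-∈ˡ (there p) = there (Before-∈ˡ p)

Before-∈ʳ : ∀ {xs a b} → Before xs a b → b ∈ xs
Before-∈ʳ (here b∈) = there b∈
Before-∈ʳ (there p) = there (Before-∈ʳ p)

Before-++⁺ˡ : ∀ {xs ys a b} → Before xs a b → Before (xs ++ ys) a b
Before-++⁺ˡ (here b∈) = here (∈-++⁺ˡ b∈)
Before-++⁺ˡ (there p) = there (Before-++⁺ˡ p)

Before-++⁺ʳ : ∀ xs {ys a b} → Before ys a b → Before (xs ++ ys) a b
Before-++⁺ʳ []       p = p
Before-++⁺ʳ (x ∷ xs) p = there (Before-++⁺ʳ xs p)

Before-++⁺ : ∀ {xs ys a b} → a ∈ xs → b ∈ ys → Before (xs ++ ys) a b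
Before-++⁺ {x ∷ xs} (here refl) b∈ = here (∈-++⁺ʳ xs b∈)
Before-++⁺          (there a∈)  b∈ = there (Before-++⁺ a∈ b∈)

Before-++⁻ : ∀ xs {ys a b} → Before (xs ++ ys) a b →
  Before xs a b ⊎ (a ∈ xs × b ∈ ys) ⊎ Before ys a b
Before-++⁻ []       p = inj₂ (inj₂ p)
Before-++⁻ (x ∷ xs) (here b∈) with ∈-++⁻ xs b∈
... | inj₁ b∈xs = inj₁ (here b∈xs)
... | inj₂ b∈ys = inj₂ (inj₁ (here refl , b∈ys))
Before-++⁻ (x ∷ xs) (there p) with Before-++⁻ xs p
... | inj₁ q               = inj₁ (there q)
... | inj₂ (inj₁ (a∈ , b∈)) = inj₂ (inj₁ (there a∈ , b∈))
... | inj₂ (inj₂ q)        = inj₂ (inj₂ q)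

∈-filterB⁺ : ∀ p {xs a} → a ∈ xs → T (p a) → a ∈ filterB p xs
∈-filterB⁺ p {x ∷ xs} a∈ pa with p x in eq
∈-filterB⁺ p (here refl) pa | true  = here refl
∈-filterB⁺ p (there a∈)  pa | true  = there (∈-filterB⁺ p a∈ pa)
∈-filterB⁺ p (here refl) pa | false = ⊥-elim (subst T eq pa)
∈-filterB⁺ p (there a∈)  pa | false = ∈-filterB⁺ p a∈ pa

∈-filterB⁻ : ∀ p xs {a} → a ∈ filterB p xs → a ∈ xs × T (p a)
∈-filterB⁻ p (x ∷ xs) a∈ with p x in eq
∈-filterB⁻ p (x ∷ xs) (here refl) | true = here refl , subst T (sym eq) tt
∈-filterB⁻ p (x ∷ xs) (there a∈)  | true  with a∈xs , pa ← ∈-filterB⁻ p xs a∈ = there a∈xs , pa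
∈-filterB⁻ p (x ∷ xs) a∈          | false with a∈xs , pa ← ∈-filterB⁻ p xs a∈ = there a∈xs , pa

Before-filterB⁺ : ∀ p {xs a b} → Before xs a b → T (p a) → T (p b) → Before (filterB p xs) a b
Before-filterB⁺ p {x ∷ xs} ab pa pb with p x in eq
Before-filterB⁺ p (here b∈)  pa pb | true  = here (∈-filterB⁺ p b∈ pb)
Before-filterB⁺ p (there ab) pa pb | true  = there (Before-filterB⁺ p ab pa pb)
Before-filterB⁺ p (here b∈)  pa pb | false = ⊥-elim (subst T eq pa)
Before-filterB⁺ p (there ab) pa pb | false = Before-filterB⁺ p ab pa pb

Before-filterB⁻ : ∀ p xs {a b} → Before (filterB p xs) a b → Before xs a b
Before-filterB⁻ p (x ∷ xs) ab with p x
Before-filterB⁻ p (x ∷ xs) (here b∈)  | true  = here (proj₁ (∈-filterB⁻ p xs b∈))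
Before-filterB⁻ p (x ∷ xs) (there ab) | true  = there (Before-filterB⁻ p xs ab)
Before-filterB⁻ p (x ∷ xs) ab         | false = there (Before-filterB⁻ p xs ab)

-- A single sweep

splitV-spec : ∀ i σ → i ∈ σ → i ∉ proj₁ (splitV i σ) ×
  ∃ λ rest → proj₂ (splitV i σ) ≡ i ∷ rest × σ ≡ proj₁ (splitV i σ) ++ i ∷ rest
splitV-spec i (x ∷ σ) i∈ with x ≡ᵇ i in eq
... | true with refl ← ≡ᵇ⇒≡ x i (subst T (sym eq) tt) = (λ ()) , σ , refl , refl
splitV-spec i (x ∷ σ) (here refl) | false = ⊥-elim (subst T eq (≡⇒≡ᵇ i i refl))
splitV-spec i (x ∷ σ) (there i∈)  | false
  with i∉ , rest , p , q ← splitV-spec i σ i∈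
  = (λ { (here refl) → subst T eq (≡⇒≡ᵇ i i refl) ; (there i∈′) → i∉ i∈′ }) , rest , p , cong (x ∷_) q

filters-↭ : ∀ i xs → i ∉ xs → filterB (i <ᵇ_) xs ++ filterB (_<ᵇ i) xs ↭ xs
filters-↭ i []       _  = ↭-refl
filters-↭ i (x ∷ xs) i∉ with i <ᵇ x in gt | x <ᵇ i in lt
... | true  | true  = ⊥-elim (<-asym (<ᵇ⇒< i x (subst T (sym gt) tt)) (<ᵇ⇒< x i (subst T (sym lt) tt)))
... | true  | false = prep x (filters-↭ i xs (i∉ ∘ there))
... | false | true  = ↭-trans (shift x (filterB (i <ᵇ_) xs) _) (prep x (filters-↭ i xs (i∉ ∘ there)))
... | false | false with <-cmp i x
...   | tri< i<x _ _ = ⊥-elim (subst T gt (<⇒<ᵇ i<x))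
...   | tri≈ _ i≡x _ = ⊥-elim (i∉ (here i≡x))
...   | tri> _ _ x<i = ⊥-elim (subst T lt (<⇒<ᵇ x<i))

swrI-↭ : ∀ i σ → i ∈ σ → swrI i σ ↭ σ
swrI-↭ i σ i∈ with i∉ , rest , post≡ , σ≡ ← splitV-spec i σ i∈
  with pre ← proj₁ (splitV i σ) | post ← proj₂ (splitV i σ)
  rewrite post≡ | σ≡ = ↭-trans (↭-sym (++-assoc (filterB (i <ᵇ_) pre) _ _)) (++⁺ʳ _ (filters-↭ i pre i∉))

Unique-++ : ∀ (xs : List ℕ) {ys v} → Unique (xs ++ ys) → v ∈ xs → v ∉ ys
Unique-++ (x ∷ xs) (x∉ ∷ _) (here refl) v∈ys = All.lookup x∉ (∈-++⁺ʳ xs v∈ys) refl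
Unique-++ (x ∷ xs) (_ ∷ u)  (there v∈)  v∈ys = Unique-++ xs u v∈ v∈ys

module _ (i : ℕ) (σ : List ℕ) (unique : Unique σ) (i∈ : i ∈ σ) {a b : ℕ} (a<b : a < b) where

  -- The sweep only rearranges the entries left of `i`, larger ones first. It creates no pair with
  -- the smaller value in front, and it destroys such a pair when `a < i < b` and both stand before
  -- `i`.
  swrI-before⁻ : Before (swrI i σ) a b → Before σ a b × (a < i → i < b → Before σ i b)
  swrI-before⁻ ab with i∉ , rest , post≡ , σ≡ ← splitV-spec i σ i∈
    with pre ← proj₁ (splitV i σ) | post ← proj₂ (splitV i σ)
    rewrite post≡ | σ≡ = go
    where
    High Low : List ℕ
    High = filterB (i <ᵇ_) pre
    Low  = filterB (_<ᵇ i) pre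
    later : ∀ {x} → x ∈ i ∷ rest → i < x → Before (pre ++ i ∷ rest) i x
    later (here refl) i<x = ⊥-elim (<-irrefl refl i<x)
    later (there x∈)  _   = Before-++⁺ʳ pre (here x∈)
    high : ∀ {x} → x ∈ High → x ∈ pre × i < x
    high x∈ with x∈pre , t ← ∈-filterB⁻ (i <ᵇ_) pre x∈ = x∈pre , <ᵇ⇒< i _ t
    low : ∀ {x} → x ∈ Low → x ∈ pre × x < i
    low x∈ with x∈pre , t ← ∈-filterB⁻ (_<ᵇ i) pre x∈ = x∈pre , <ᵇ⇒< _ i t
    go : Before (pre ++ i ∷ rest) a b × (a < i → i < b → Before (pre ++ i ∷ rest) i b)
    go with Before-++⁻ High ab
    ... | inj₁ p = Before-++⁺ˡ (Before-filterB⁻ _ pre p) ,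
          λ a<i → ⊥-elim (<-asym a<i (proj₂ (high (Before-∈ˡ p))))
    ... | inj₂ (inj₁ (a∈ , b∈)) with a∈pre , i<a ← high a∈ | ∈-++⁻ Low b∈
    ...   | inj₁ b∈Low = ⊥-elim (<-asym a<b (<-trans (proj₂ (low b∈Low)) i<a))
    ...   | inj₂ b∈post = Before-++⁺ a∈pre b∈post , λ a<i → ⊥-elim (<-asym a<i i<a)
    go | inj₂ (inj₂ p) with Before-++⁻ Low p
    ...   | inj₁ q = Before-++⁺ˡ (Before-filterB⁻ _ pre q) ,
            λ _ i<b → ⊥-elim (<-asym i<b (proj₂ (low (Before-∈ʳ q))))
    ...   | inj₂ (inj₁ (a∈ , b∈)) = Before-++⁺ (proj₁ (low a∈)) b∈ , λ _ → later b∈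
    ...   | inj₂ (inj₂ q) = Before-++⁺ʳ pre q , λ _ → later (Before-∈ʳ q)

  swrI-before⁺ : Before σ a b → (a < i → i < b → Before σ i b) → Before (swrI i σ) a b
  swrI-before⁺ ab ib with i∉ , rest , post≡ , σ≡ ← splitV-spec i σ i∈
    with pre ← proj₁ (splitV i σ) | post ← proj₂ (splitV i σ)
    rewrite post≡ | σ≡ = go (Before-++⁻ pre ab)
    where
    High Low : List ℕ
    High = filterB (i <ᵇ_) pre
    Low  = filterB (_<ᵇ i) pre
    go : Before pre a b ⊎ (a ∈ pre × b ∈ i ∷ rest) ⊎ Before (i ∷ rest) a b →
         Before (High ++ Low ++ i ∷ rest) a b
    go (inj₁ p) with <-cmp a i
    ... | tri≈ _ refl _ = ⊥-elim (i∉ (Before-∈ˡ p))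
    ... | tri> _ _ i<a = Before-++⁺ˡ (Before-filterB⁺ _ p (<⇒<ᵇ i<a) (<⇒<ᵇ (<-trans i<a a<b)))
    ... | tri< a<i _ _ with <-cmp b i
    ...   | tri< b<i _ _ = Before-++⁺ʳ High (Before-++⁺ˡ (Before-filterB⁺ _ p (<⇒<ᵇ a<i) (<⇒<ᵇ b<i)))
    ...   | tri≈ _ refl _ = ⊥-elim (i∉ (Before-∈ʳ p))
    -- This is the pair the sweep would swap. By `ib` the value `b` also occurs after `i`, against
    -- uniqueness.
    ...   | tri> _ _ i<b with Before-++⁻ pre (ib a<i i<b)
    ...     | inj₁ q = ⊥-elim (i∉ (Before-∈ˡ q))
    ...     | inj₂ (inj₁ (i∈pre , _)) = ⊥-elim (i∉ i∈pre)
    ...     | inj₂ (inj₂ q) = ⊥-elim (Unique-++ pre unique (Before-∈ʳ p) (Before-∈ʳ q))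
    go (inj₂ (inj₁ (a∈ , b∈))) with <-cmp a i
    ... | tri< a<i _ _ = Before-++⁺ʳ High (Before-++⁺ (∈-filterB⁺ _ a∈ (<⇒<ᵇ a<i)) b∈)
    ... | tri≈ _ refl _ = ⊥-elim (i∉ a∈)
    ... | tri> _ _ i<a = Before-++⁺ (∈-filterB⁺ _ a∈ (<⇒<ᵇ i<a)) (∈-++⁺ʳ Low b∈)
    go (inj₂ (inj₂ q)) = Before-++⁺ʳ High (Before-++⁺ʳ Low q)

-- The composition of all sweeps

Unique-↭ : ∀ {xs ys : List ℕ} → xs ↭ ys → Unique xs → Unique ys
Unique-↭ p = ↭ₛ.Unique-resp-↭ (setoid ℕ) (↭⇒↭ₛ p)

foldr-swrI-↭ : ∀ is π → (∀ {i} → i ∈ is → i ∈ π) → foldr swrI π is ↭ π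
foldr-swrI-↭ []       π _   = ↭-refl
foldr-swrI-↭ (i ∷ is) π is⊆ with IH ← foldr-swrI-↭ is π (λ i∈ → is⊆ (there i∈))
  = ↭-trans (swrI-↭ i _ (∈-resp-↭ (↭-sym IH) (is⊆ (here refl)))) IH

Chained : List ℕ → List ℕ → ℕ → ℕ → Set
Chained π is a b = Before π a b × (∀ {c} → c ∈ is → a < c → c < b → Before π c b)

module _ (π : List ℕ) (unique : Unique π) where

  -- Undoing the last sweep yields `a` before `b`, and also `i` before `b` when `a < i < b`;
  -- induction pulls each of the two pairs back to `π`.
  foldr-swrI-before⁻ : ∀ is → (∀ {i} → i ∈ is → i ∈ π) → ∀ {a b} → a < b →
    Before (foldr swrI π is) a b → Chained π is a b
  foldr-swrI-before⁻ []       _   a<b ab = ab , λ ()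
  foldr-swrI-before⁻ (i ∷ is) is⊆ a<b ab
    with perm ← foldr-swrI-↭ is π (λ i∈ → is⊆ (there i∈)) | IH ← foldr-swrI-before⁻ is (λ i∈ → is⊆ (there i∈))
    with ab′ , ib ← swrI-before⁻ i _ (Unique-↭ (↭-sym perm) unique) (∈-resp-↭ (↭-sym perm) (is⊆ (here refl))) a<b ab
    = proj₁ (IH a<b ab′) ,
      λ { (here refl) a<c c<b → proj₁ (IH c<b (ib a<c c<b)) ; (there c∈) → proj₂ (IH a<b ab′) c∈ }

  foldr-swrI-before⁺ : ∀ is → (∀ {i} → i ∈ is → i ∈ π) → ∀ {a b} → a < b →
    Chained π is a b → Before (foldr swrI π is) a b
  foldr-swrI-before⁺ []       _   a<b (ab , _) = ab
  foldr-swrI-before⁺ (i ∷ is) is⊆ a<b (ab , between)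
    with perm ← foldr-swrI-↭ is π (λ i∈ → is⊆ (there i∈)) | IH ← foldr-swrI-before⁺ is (λ i∈ → is⊆ (there i∈))
    = swrI-before⁺ i _ (Unique-↭ (↭-sym perm) unique) (∈-resp-↭ (↭-sym perm) (is⊆ (here refl))) a<b
        (IH a<b (ab , between ∘ there))
        -- The pair `i < b` inherits the chain condition, since a value between `i` and `b` is also
        -- between `a` and `b`.
        (λ a<i i<b → IH i<b (between (here refl) a<i i<b ,
          λ c∈ i<c c<b → between (there c∈) (<-trans a<i i<c) c<b))

-- Positions and heights as inverse maps

index : List ℕ → ℕ → ℕ
index []       v = 0
index (x ∷ xs) v with x ≟ v
... | yes _ = 1
... | no  _ = suc (index xs v)

index≥1 : ∀ {xs v} → v ∈ xs → 1 ≤ index xs v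
index≥1 {x ∷ xs} {v} _ with x ≟ v
... | yes _ = s≤s z≤n
... | no  _ = s≤s z≤n

at-suc : ∀ x xs k → 1 ≤ k → at (x ∷ xs) (suc k) ≡ at xs k
at-suc x xs (suc k) _ = refl

at-index : ∀ {xs v} → v ∈ xs → at xs (index xs v) ≡ v
at-index {x ∷ xs} {v} v∈ with x ≟ v
at-index v∈          | yes x≡v = x≡v
at-index (here refl) | no x≢v = ⊥-elim (x≢v refl)
at-index {x ∷ xs} (there v∈) | no x≢v = trans (at-suc x xs _ (index≥1 v∈)) (at-index v∈)

index≤length : ∀ {xs v} → v ∈ xs → index xs v ≤ length xs
index≤length {x ∷ xs} {v} v∈ with x ≟ v
... | yes _ = s≤s z≤n
index≤length (here refl) | no x≢v = ⊥-elim (x≢v refl)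
index≤length (there v∈)  | no x≢v = s≤s (index≤length v∈)

at-∈ : ∀ xs {i} → InRange xs i → at xs i ∈ xs
at-∈ (x ∷ xs) {suc zero}    _              = here refl
at-∈ (x ∷ xs) {suc (suc i)} (_ , s≤s i≤)   = there (at-∈ xs (s≤s z≤n , i≤))
at-∈ []       {suc i}       (_ , ())
at-∈ []       {zero}        (() , _)

index-at : ∀ {xs i} → Unique xs → InRange xs i → index xs (at xs i) ≡ i
index-at {x ∷ xs} {suc zero} _ _ with x ≟ x
... | yes _  = refl
... | no x≢x = ⊥-elim (x≢x refl)
index-at {x ∷ xs} {suc (suc i)} (x∉ ∷ u) (_ , s≤s i≤) with x ≟ at xs (suc i)
... | yes x≡ = ⊥-elim (All.lookup x∉ (at-∈ xs (s≤s z≤n , i≤)) x≡)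
... | no  _  = cong suc (index-at u (s≤s z≤n , i≤))
index-at {[]} {suc i} _ (_ , ())
index-at {[]} {zero}  _ (() , _)

Before⇒index : ∀ {xs a b} → Unique xs → Before xs a b → index xs a < index xs b
Before⇒index {x ∷ xs} {a} {b} (x∉ ∷ u) ab with x ≟ a | x ≟ b
Before⇒index (x∉ ∷ u) (here b∈)  | _ | yes refl = ⊥-elim (All.lookup x∉ b∈ refl)
Before⇒index (x∉ ∷ u) (there ab) | _ | yes refl = ⊥-elim (All.lookup x∉ (Before-∈ʳ ab) refl)
Before⇒index (x∉ ∷ u) ab         | yes refl | no _ with ab
... | here b∈   = s≤s (index≥1 b∈)
... | there ab′ = s≤s (index≥1 (Before-∈ʳ ab′))
Before⇒index (x∉ ∷ u) (here b∈)  | no x≢a | no _ = ⊥-elim (x≢a refl)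
Before⇒index (x∉ ∷ u) (there ab) | no _   | no _ = s≤s (Before⇒index u ab)

index⇒Before : ∀ {xs a b} → a ∈ xs → b ∈ xs → index xs a < index xs b → Before xs a b
index⇒Before {x ∷ xs} {a} {b} a∈ b∈ lt with x ≟ a | x ≟ b
index⇒Before a∈ b∈ (s≤s ()) | yes _ | yes _
index⇒Before a∈ (here refl) _ | yes _ | no x≢b = ⊥-elim (x≢b refl)
index⇒Before a∈ (there b∈)  _ | yes refl | no _ = here b∈
index⇒Before a∈ b∈ (s≤s ()) | no _ | yes _
index⇒Before (here refl) _ _ | no x≢a | no _ = ⊥-elim (x≢a refl)
index⇒Before _ (here refl) _ | no _ | no x≢b = ⊥-elim (x≢b refl)
index⇒Before (there a∈) (there b∈) (s≤s lt) | no _ | no _ = there (index⇒Before a∈ b∈ lt)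

-- A permutation as a pair of functions, heights by position and positions by height; nothing is
-- required outside `1, …, n`.
record Inverse (n : ℕ) (f f⁻¹ : ℕ → ℕ) : Set where
  field
    f-range   : ∀ {i} → 1 ≤ i → i ≤ n → 1 ≤ f i × f i ≤ n
    f⁻¹-range : ∀ {v} → 1 ≤ v → v ≤ n → 1 ≤ f⁻¹ v × f⁻¹ v ≤ n
    f-f⁻¹     : ∀ {v} → 1 ≤ v → v ≤ n → f (f⁻¹ v) ≡ v
    f⁻¹-f     : ∀ {i} → 1 ≤ i → i ≤ n → f⁻¹ (f i) ≡ i

module _ {n : ℕ} {π : List ℕ} (perm : IsPerm n π) where

  length-perm : length π ≡ n
  length-perm = trans (↭-length perm) (trans (length-map suc (upTo n)) (length-upTo n))

  ∈-perm⁺ : ∀ {v} → 1 ≤ v → v ≤ n → v ∈ π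
  ∈-perm⁺ {suc v} _ v≤n = ∈-resp-↭ (↭-sym perm) (∈-map⁺ suc (∈-upTo⁺ v≤n))

  ∈-perm⁻ : ∀ {v} → v ∈ π → 1 ≤ v × v ≤ n
  ∈-perm⁻ v∈ with i , i∈ , refl ← ∈-map⁻ suc (∈-resp-↭ perm v∈) = s≤s z≤n , ∈-upTo⁻ i∈

  Unique-perm : Unique π
  Unique-perm = Unique-↭ (↭-sym perm) (Unique.map⁺ suc-injective (Unique.upTo⁺ n))

  at-inverse : Inverse n (at π) (index π)
  at-inverse = record
    { f-range   = λ 1≤i i≤n → ∈-perm⁻ (at-∈ π (1≤i , subst (_ ≤_) (sym length-perm) i≤n))
    ; f⁻¹-range = λ 1≤v v≤n → index≥1 (∈-perm⁺ 1≤v v≤n) , subst (_ ≤_) length-perm (index≤length (∈-perm⁺ 1≤v v≤n))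
    ; f-f⁻¹     = λ 1≤v v≤n → at-index (∈-perm⁺ 1≤v v≤n)
    ; f⁻¹-f     = λ 1≤i i≤n → index-at Unique-perm (1≤i , subst (_ ≤_) (sym length-perm) i≤n)
    }

  private
    steps⊆ : ∀ {i} → i ∈ map suc (upTo (length π)) → i ∈ π
    steps⊆ i∈ = ∈-resp-↭ (↭-sym perm) (subst (λ m → _ ∈ map suc (upTo m)) length-perm i∈)

    swr↭ : π ↭ swr π
    swr↭ = ↭-sym (foldr-swrI-↭ _ π steps⊆)

  swr-perm : IsPerm n (swr π)
  swr-perm = ↭-trans (foldr-swrI-↭ _ π steps⊆) perm

  -- `swr` sweeps at every value of `1, …, n`, so the chain condition ranges over all values between
  -- `a` and `b`.
  swr-index⁻ : ∀ {a b} → 1 ≤ a → a < b → b ≤ n → index (swr π) a < index (swr π) b →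
    index π a < index π b × (∀ {c} → a < c → c < b → index π c < index π b)
  swr-index⁻ 1≤a a<b b≤n lt
    with ab , between ← foldr-swrI-before⁻ π Unique-perm _ steps⊆ a<b
      (index⇒Before (∈-resp-↭ swr↭ (∈-perm⁺ 1≤a (≤-trans (<⇒≤ a<b) b≤n)))
        (∈-resp-↭ swr↭ (∈-perm⁺ (≤-trans 1≤a (<⇒≤ a<b)) b≤n)) lt)
    = Before⇒index Unique-perm ab , λ a<c c<b → Before⇒index Unique-perm
        (between (subst (λ m → _ ∈ map suc (upTo m)) (sym length-perm)
          (∈-resp-↭ perm (∈-perm⁺ (≤-trans 1≤a (<⇒≤ a<c)) (≤-trans (<⇒≤ c<b) b≤n)))) a<c c<b)

  swr-index⁺ : ∀ {a b} → 1 ≤ a → a < b → b ≤ n → index π a < index π b →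
    (∀ {c} → a < c → c < b → index π c < index π b) → index (swr π) a < index (swr π) b
  swr-index⁺ {a} {b} 1≤a a<b b≤n lt between = Before⇒index (Unique-↭ swr↭ Unique-perm)
    (foldr-swrI-before⁺ π Unique-perm _ steps⊆ a<b
      (before 1≤a (<⇒≤ a<b) lt , λ _ a<c c<b → before (≤-trans 1≤a (<⇒≤ a<c)) (<⇒≤ c<b) (between a<c c<b)))
    where
    before : ∀ {c} → 1 ≤ c → c ≤ b → index π c < index π b → Before π c b
    before 1≤c c≤b = index⇒Before (∈-perm⁺ 1≤c (≤-trans c≤b b≤n)) (∈-perm⁺ (≤-trans 1≤a (<⇒≤ a<b)) b≤n)

-- Counting in a staircase of left-to-right maxima

largest-below : ∀ {P : ℕ → Set} → Decidable P → ∀ w →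
  (∃ λ y → y < w × P y × (∀ {z} → y < z → z < w → ¬ P z)) ⊎ (∀ {z} → z < w → ¬ P z)
largest-below P? zero = inj₂ λ ()
largest-below P? (suc w) with P? w
... | yes Pw = inj₁ (w , ≤-refl , Pw , λ w<z z<1+w → ⊥-elim (<⇒≱ w<z (≤-pred z<1+w)))
... | no ¬Pw with largest-below P? w
...   | inj₁ (y , y<w , Py , above) = inj₁ (y , m<n⇒m<1+n y<w , Py , λ {z} y<z z<1+w → above′ z y<z (m≤n⇒m<n∨m≡n (≤-pred z<1+w)))
  where
  above′ : ∀ z → y < z → z < w ⊎ z ≡ w → ¬ _
  above′ z y<z (inj₁ z<w)  = above y<z z<w
  above′ z y<z (inj₂ refl) = ¬Pw
...   | inj₂ none = inj₂ λ {z} z<1+w → none′ z (m≤n⇒m<n∨m≡n (≤-pred z<1+w))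
  where
  none′ : ∀ z → z < w ⊎ z ≡ w → ¬ _
  none′ z (inj₁ z<w)  = none z<w
  none′ z (inj₂ refl) = ¬Pw

least : ∀ {P : ℕ → Set} → Decidable P → ∀ v → P v →
  ∃ λ q → q ≤ v × P q × (∀ {z} → z < q → ¬ P z)
least P? zero    P0 = 0 , z≤n , P0 , λ ()
least P? (suc v) Pv with P? 0
... | yes P0 = 0 , z≤n , P0 , λ ()
... | no ¬P0 with q , q≤v , Pq , below ← least (P? ∘ suc) v Pv
  = suc q , s≤s q≤v , Pq , λ { {zero} _ → ¬P0 ; {suc z} (s≤s z<q) → below z<q }

lookup-injective : ∀ {xs : List ℕ} → Unique xs → ∀ {i j} → lookup xs i ≡ lookup xs j → i ≡ j
lookup-injective (x∉ ∷ u) {zero}  {zero}  eq = refl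
lookup-injective (x∉ ∷ u) {zero}  {suc j} eq = ⊥-elim (All.lookup x∉ (∈-lookup j) eq)
lookup-injective (x∉ ∷ u) {suc i} {zero}  eq = ⊥-elim (All.lookup x∉ (∈-lookup i) (sym eq))
lookup-injective (x∉ ∷ u) {suc i} {suc j} eq = cong suc (lookup-injective u eq)

-- Pigeonhole: subtracting `lo` gives an injection from the list indices into `Fin (hi ∸ lo)`.
unique-length≤ : ∀ {xs lo hi} → Unique xs → All (λ x → lo ≤ x × x < hi) xs → length xs ≤ hi ∸ lo
unique-length≤ {xs} {lo} {hi} u bounds = injective⇒≤ {f = shifted} λ {i} {j} eq →
  lookup-injective u (∸-cancelʳ-≡ (lo≤ i) (lo≤ j) (fromℕ<-injective _ _ (fits i) (fits j) eq))
  where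
  lo≤ : ∀ i → lo ≤ lookup xs i
  lo≤ i = proj₁ (All.lookup bounds (∈-lookup i))
  fits : ∀ i → lookup xs i ∸ lo < hi ∸ lo
  fits i = ∸-monoˡ-< (proj₂ (All.lookup bounds (∈-lookup i))) (lo≤ i)
  shifted : Fin (length xs) → Fin (hi ∸ lo)
  shifted i = fromℕ< (fits i)

-- Strictly between two consecutive values lies one integer fewer than their difference, so `m` gaps
-- fall short of the whole drop by `m`.
telescope : ∀ (h : ℕ → ℕ) m → (∀ {j} → j < m → h (suc j) < h j) →
  total (λ j → h j ∸ h (suc j) ∸ 1) m + m + h m ≡ h 0
telescope h zero    _    = refl
telescope h (suc m) decr = begin
  g + t + suc m + h (suc m)   ≡⟨ cong (_+ h (suc m)) (+-suc (g + t) m) ⟩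
  suc (g + t + m) + h (suc m) ≡⟨ cong (λ e → suc e + h (suc m)) (+-assoc g t m) ⟩
  suc (g + (t + m)) + h (suc m) ≡⟨ cong suc (+-assoc g (t + m) (h (suc m))) ⟩
  suc (g + (t + m + h (suc m))) ≡⟨ cong (λ e → suc (g + e)) (telescope (h ∘ suc) m (decr ∘ s≤s)) ⟩
  suc (g + h 1)               ≡⟨ cong suc (+-comm g (h 1)) ⟩
  suc (h 1 + g)               ≡⟨ sym (+-suc (h 1) g) ⟩
  h 1 + suc g                 ≡⟨ cong (h 1 +_) (m+[n∸m]≡n (m<n⇒0<n∸m (decr (s≤s z≤n)))) ⟩
  h 1 + (h 0 ∸ h 1)           ≡⟨ m+[n∸m]≡n (<⇒≤ (decr (s≤s z≤n))) ⟩
  h 0 ∎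
  where
  open ≡-Reasoning
  g = h 0 ∸ h 1 ∸ 1
  t = total (λ j → h (suc j) ∸ h (suc (suc j)) ∸ 1) m

-- `count` peels off the first block, whereas the list of marked positions grows at the last one.
count-last : ∀ B t → count B (suc t) ≡ (if B t then 1 else 0) + count B t
count-last B zero    = refl
count-last B (suc t) = trans
  (cong ((if B 0 then 1 else 0) +_) (count-last (B ∘ suc) t))
  (+-swap (if B 0 then 1 else 0) (if B (suc t) then 1 else 0) (count (B ∘ suc) t))

-- Consecutive left-to-right maxima read from the right. The corner `r (suc L)` closes the last
-- step; in the application it is the sentinel 0, of height 0.
record Staircase (n : ℕ) (f r : ℕ → ℕ) (L : ℕ) : Set where
  field
    bound : ∀ {j} → j ≤ L → r j ≤ n
    drop  : ∀ {j} → j ≤ L → r (suc j) < r j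
    fall  : ∀ {j} → j ≤ L → f (r (suc j)) < f (r j)
    below : ∀ {j p} → j ≤ L → 1 ≤ p → p < r j → f p ≤ f (r (suc j))

-- Descent tops of `swr π`, with `f` for `π` and `g` for `swr π`

module _ {n : ℕ} {f f⁻¹ g g⁻¹ : ℕ → ℕ} (f-inv : Inverse n f f⁻¹) (g-inv : Inverse n g g⁻¹)
  (av312 : ∀ a b c → 1 ≤ a → a < b → b < c → c ≤ n → ¬ (f b < f c × f c < f a))
  (order⁻ : ∀ {a b} → 1 ≤ a → a < b → b ≤ n → g⁻¹ a < g⁻¹ b →
     f⁻¹ a < f⁻¹ b × (∀ {c} → a < c → c < b → f⁻¹ c < f⁻¹ b))
  (order⁺ : ∀ {a b} → 1 ≤ a → a < b → b ≤ n → f⁻¹ a < f⁻¹ b →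
     (∀ {c} → a < c → c < b → f⁻¹ c < f⁻¹ b) → g⁻¹ a < g⁻¹ b)
  where
  private
    module F = Inverse f-inv
    module G = Inverse g-inv

    f⁻¹-injective : ∀ {v w} → 1 ≤ v → v ≤ n → 1 ≤ w → w ≤ n → f⁻¹ v ≡ f⁻¹ w → v ≡ w
    f⁻¹-injective 1≤v v≤n 1≤w w≤n eq = trans (sym (F.f-f⁻¹ 1≤v v≤n)) (trans (cong f eq) (F.f-f⁻¹ 1≤w w≤n))

  module _ {a : ℕ} (1≤a : 1 ≤ a) (a<n : a < n) (ga+1<ga : g (suc a) < g a) where
    private
      x z p : ℕ
      x = g a
      z = g (suc a)
      p = f⁻¹ x
      1≤x = proj₁ (G.f-range 1≤a (<⇒≤ a<n))
      x≤n = proj₂ (G.f-range 1≤a (<⇒≤ a<n))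
      1≤z = proj₁ (G.f-range (s≤s z≤n) a<n)
      1≤p = proj₁ (F.f⁻¹-range 1≤x x≤n)
      g⁻¹x≡a : g⁻¹ x ≡ a
      g⁻¹x≡a = G.f⁻¹-f 1≤a (<⇒≤ a<n)
      g⁻¹z≡a+1 : g⁻¹ z ≡ suc a
      g⁻¹z≡a+1 = G.f⁻¹-f (s≤s z≤n) a<n

      -- If all values from `z` up to just below `x` preceded `x` in `π`, the order criterion would
      -- put `z` before `x` in `swr π`, where it directly follows `x`.
      lower-later : ∃ λ c → z ≤ c × c < x × p < f⁻¹ c
      lower-later with largest-below (λ c → p ≤? f⁻¹ c) x
      ... | inj₁ (c , c<x , p≤c , above) with z ≤? c
      ...   | yes z≤c = c , z≤c , c<x ,
              ≤∧≢⇒< p≤c λ eq → <⇒≢ c<x (sym (f⁻¹-injective 1≤x x≤n (≤-trans 1≤z z≤c) (≤-trans (<⇒≤ c<x) x≤n) eq))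
      ...   | no z≰c = ⊥-elim (<-asym (order⁺ 1≤z ga+1<ga x≤n (≰⇒> (above (≰⇒> z≰c) ga+1<ga))
                λ z<c′ c′<x → ≰⇒> (above (<-trans (≰⇒> z≰c) z<c′) c′<x))
                (subst₂ _<_ (sym g⁻¹x≡a) (sym g⁻¹z≡a+1) ≤-refl))
      lower-later | inj₂ none = ⊥-elim (<-asym (order⁺ 1≤z ga+1<ga x≤n (≰⇒> (none ga+1<ga))
                λ _ c′<x → ≰⇒> (none c′<x))
                (subst₂ _<_ (sym g⁻¹x≡a) (sym g⁻¹z≡a+1) ≤-refl))

    -- If π rose right after x, let q be the least value above x that comes later in π.  Then q follows x,
    -- hence z, in swr π, so some value c < x sits between x and q in π; the successor of x in π, c and q
    -- form the pattern 312.
    descent-transfer : p < n × f (suc p) < x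
    descent-transfer with c , z≤c , c<x , p<c ← lower-later = p<n , ≰⇒> no-ascent
      where
      c≤n : c ≤ n
      c≤n = ≤-trans (<⇒≤ c<x) x≤n
      1≤c : 1 ≤ c
      1≤c = ≤-trans 1≤z z≤c
      p<n : p < n
      p<n = ≤-trans p<c (proj₂ (F.f⁻¹-range 1≤c c≤n))
      v : ℕ
      v = f (suc p)
      v-pos : f⁻¹ v ≡ suc p
      v-pos = F.f⁻¹-f (s≤s z≤n) p<n
      v≤n : v ≤ n
      v≤n = proj₂ (F.f-range (s≤s z≤n) p<n)
      no-ascent : ¬ x ≤ v
      no-ascent x≤v
        -- The entry `v` right after `x` is itself a candidate, so the least one exists and is at
        -- most `v`.
        with q , q≤v , (x<q , p<q) , least-q ← least (λ q → (x <? q) ×-dec (p <? f⁻¹ q)) v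
               (≤∧≢⇒< x≤v (λ x≡v → 1+n≢n (sym (trans (cong f⁻¹ x≡v) v-pos))) , ≤-reflexive (sym v-pos))
        = conclude (m≤n⇒m<n∨m≡n q≤v)
        where
        q≤n : q ≤ n
        q≤n = ≤-trans q≤v v≤n
        1≤q : 1 ≤ q
        1≤q = ≤-trans 1≤x (<⇒≤ x<q)
        x-before-q : g⁻¹ x < g⁻¹ q
        x-before-q = order⁺ 1≤x x<q q≤n p<q
          λ x<c′ c′<q → ≤-<-trans (≮⇒≥ λ p<c′ → least-q c′<q (x<c′ , p<c′)) p<q
        -- In `swr π` the value `z` sits directly after `x`, so `q`, being after `x` and different
        -- from `z`, is after `z` too.
        z-before-q : g⁻¹ z < g⁻¹ q
        z-before-q = ≤∧≢⇒<
          (subst (_≤ g⁻¹ q) (trans (cong suc g⁻¹x≡a) (sym g⁻¹z≡a+1)) x-before-q)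
          (λ eq → <⇒≢ (<-trans ga+1<ga x<q) (trans (sym (G.f-f⁻¹ 1≤z (≤-trans (<⇒≤ ga+1<ga) x≤n)))
            (trans (cong g eq) (G.f-f⁻¹ 1≤q q≤n))))
        c-before-q : f⁻¹ c < f⁻¹ q
        c-before-q with m≤n⇒m<n∨m≡n z≤c
        ... | inj₂ refl = proj₁ (order⁻ 1≤z (<-trans ga+1<ga x<q) q≤n z-before-q)
        ... | inj₁ z<c  = proj₂ (order⁻ 1≤z (<-trans ga+1<ga x<q) q≤n z-before-q) z<c (<-trans c<x x<q)
        v-before-c : suc p < f⁻¹ c
        v-before-c = ≤∧≢⇒< p<c (λ eq → <⇒≢ (<-≤-trans c<x x≤v) (trans (sym (F.f-f⁻¹ 1≤c c≤n)) (cong f (sym eq))))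
        conclude : q < v ⊎ q ≡ v → ⊥
        conclude (inj₂ refl) = <-asym v-before-c (subst (f⁻¹ c <_) v-pos c-before-q)
        conclude (inj₁ q<v)  = av312 (suc p) (f⁻¹ c) (f⁻¹ q) (s≤s z≤n) v-before-c c-before-q
          (proj₂ (F.f⁻¹-range 1≤q q≤n))
          ( subst₂ _<_ (sym (F.f-f⁻¹ 1≤c c≤n)) (sym (F.f-f⁻¹ 1≤q q≤n)) (<-trans c<x x<q)
          , subst₂ _<_ (sym (F.f-f⁻¹ 1≤q q≤n)) refl q<v )

  -- Hooks of `swr π` and the positions they mark in `π`

  module _ (Hooked : ℕ → ℕ → Set)
    (hooked-below : ∀ {x w} → Hooked x w → x < w × g⁻¹ x < g⁻¹ w)
    (hooked-descent : ∀ {x w} → Hooked x w → ∃ λ a → 1 ≤ a × a < n × x ≡ g a × g (suc a) < g a)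
    (hooked-unique : ∀ {x w w′} → Hooked x w → Hooked x w′ → w ≡ w′)
    {r : ℕ → ℕ} {L : ℕ} (stairs : Staircase n f r L) (B : ℕ → Bool)
    (hooked : ∀ {j} → j < L → B j ≡ true → ∃ λ x → Hooked x (suc (f (r (suc j)))))
    where
    open Staircase stairs
    private
      w : ℕ → ℕ
      w j = suc (f (r (suc j)))

      -- What a hook from height `v` to height `w j` provides: `v` is a descent top of `π` by
      -- `descent-transfer`, while `before` refers to `swr π`.
      record Source (j v : ℕ) : Set where
        field
          1≤v     : 1 ≤ v
          v≤n     : v ≤ n
          p<n     : f⁻¹ v < n
          descent : f (suc (f⁻¹ v)) < v
          v<w     : v < w j
          before  : g⁻¹ v < g⁻¹ (w j)

      source : ∀ {j v} → Hooked v (w j) → Source j v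
      source h with a , 1≤a , a<n , refl , desc ← hooked-descent h | v<w , before ← hooked-below h
        with p<n , descent ← descent-transfer 1≤a a<n desc
        = record { 1≤v = proj₁ (G.f-range 1≤a (<⇒≤ a<n)) ; v≤n = proj₂ (G.f-range 1≤a (<⇒≤ a<n))
                 ; p<n = p<n ; descent = descent ; v<w = v<w ; before = before }

      1≤r : ∀ {j} → j ≤ L → 1 ≤ r j
      1≤r j≤L = ≤-trans (s≤s z≤n) (drop j≤L)

      f⁻¹-r : ∀ {j} → j ≤ L → f⁻¹ (f (r j)) ≡ r j
      f⁻¹-r j≤L = F.f⁻¹-f (1≤r j≤L) (bound j≤L)

      r-anti : ∀ {i j} → j ≤ L → i < j → r j < r i
      r-anti {i} {suc j} 1+j≤L (s≤s i≤j) with m≤n⇒m<n∨m≡n i≤j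
      ... | inj₁ i<j  = <-trans (drop (<⇒≤ 1+j≤L)) (r-anti (<⇒≤ 1+j≤L) i<j)
      ... | inj₂ refl = drop (<⇒≤ 1+j≤L)

      fr-anti : ∀ {i j} → j ≤ L → i < j → f (r j) < f (r i)
      fr-anti {i} {suc j} 1+j≤L (s≤s i≤j) with m≤n⇒m<n∨m≡n i≤j
      ... | inj₁ i<j  = <-trans (fall (<⇒≤ 1+j≤L)) (fr-anti (<⇒≤ 1+j≤L) i<j)
      ... | inj₂ refl = fall (<⇒≤ 1+j≤L)

      -- If the position after `v` were a corner, `below` would put `v` under that corner, although
      -- `v` is higher than the entry following it.
      r-bottom≢ : ∀ {j k v} → k ≤ L → Source j v → suc (f⁻¹ v) ≢ r k
      r-bottom≢ {k = k} {v} k≤L s eq = <-asym (fall k≤L)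
        (<-≤-trans (subst (λ i → f i < v) eq descent)
          (subst (_≤ f (r (suc k))) (F.f-f⁻¹ 1≤v v≤n)
            (below k≤L (proj₁ (F.f⁻¹-range 1≤v v≤n)) (≤-reflexive eq))))
        where open Source s

      -- Positions charged to block `j`: its left corner and the descent bottom following the start
      -- of a hook that ends at `w j`. They turn `t + count B t` into a number of positions.
      Marked : ℕ → ℕ → Set
      Marked j x = x ≡ r (suc j) ⊎ ∃ λ v → Hooked v (w j) × x ≡ suc (f⁻¹ v)

      -- Corners differ in position and no descent bottom is a corner. Equal bottoms come from equal
      -- start heights, hence by `hooked-unique` from equal end heights, and the `w j` strictly
      -- decrease.
      marked-fresh : ∀ {i j x y} → i < L → j < L → i < j → Marked j x → Marked i y → x ≢ y
      marked-fresh i<L j<L i<j (inj₁ refl) (inj₁ refl) eq = <⇒≢ (r-anti j<L (s≤s i<j)) eq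
      marked-fresh i<L j<L i<j (inj₁ refl) (inj₂ (v , h , refl)) eq = r-bottom≢ j<L (source h) (sym eq)
      marked-fresh i<L j<L i<j (inj₂ (v , h , refl)) (inj₁ refl) eq = r-bottom≢ i<L (source h) eq
      marked-fresh i<L j<L i<j (inj₂ (v , h , refl)) (inj₂ (v′ , h′ , refl)) eq
        with refl ← f⁻¹-injective (Source.1≤v (source h)) (Source.v≤n (source h))
                      (Source.1≤v (source h′)) (Source.v≤n (source h′)) (suc-injective eq)
        = <⇒≢ (fr-anti j<L (s≤s i<j)) (suc-injective (hooked-unique h h′))

      marked-list : ∀ t → t ≤ L → ∃ λ xs → length xs ≡ t + count B t × Unique xs ×
        All (λ x → ∃ λ j → j < t × Marked j x) xs
      marked-list zero    _   = [] , refl , [] , []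
      marked-list (suc t) t<L with marked-list t (<⇒≤ t<L)
      ... | xs , len , u , marks = extend (B t) refl
        where
        fresh : ∀ {x} → Marked t x → All (x ≢_) xs
        fresh mx = All.map (λ (i , i<t , my) → marked-fresh (<-trans i<t t<L) t<L i<t mx my) marks
        old : All (λ x → ∃ λ j → j < suc t × Marked j x) xs
        old = All.map (λ (i , i<t , my) → i , m<n⇒m<1+n i<t , my) marks
        extend : ∀ b → B t ≡ b → ∃ λ xs → length xs ≡ suc t + count B (suc t) × Unique xs ×
          All (λ x → ∃ λ j → j < suc t × Marked j x) xs
        extend false eq = r (suc t) ∷ xs
          , cong suc (trans len (cong (t +_) (sym (trans (count-last B t) (cong (λ b → (if b then 1 else 0) + count B t) eq)))))
          , fresh (inj₁ refl) ∷ u , (t , ≤-refl , inj₁ refl) ∷ old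
        extend true eq with v , h ← hooked t<L eq = suc (f⁻¹ v) ∷ r (suc t) ∷ xs
          , cong suc (trans (cong suc len) (trans (sym (+-suc t _))
              (cong (t +_) (sym (trans (count-last B t) (cong (λ b → (if b then 1 else 0) + count B t) eq))))))
          , (r-bottom≢ t<L (source h) ∷ fresh (inj₂ (v , h , refl))) ∷ fresh (inj₁ refl) ∷ u
          , (t , ≤-refl , inj₂ (v , h , refl)) ∷ (t , ≤-refl , inj₁ refl) ∷ old

      γ γ′ : ℕ → ℕ
      γ j  = r j ∸ r (suc j) ∸ 1
      γ′ j = f (r (suc j)) ∸ f (r (suc (suc j))) ∸ 1

      gap : ∀ m → m ≤ L → r 0 ∸ r m ≡ total γ m + m
      gap m m≤L = trans (cong (_∸ r m) (sym (telescope r m (λ j<m → drop (≤-trans (<⇒≤ j<m) m≤L)))))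
        (m+n∸n≡m (total γ m + m) (r m))

      gap′ : ∀ m → m ≤ L → f (r 1) ∸ f (r (suc m)) ≡ total γ′ m + m
      gap′ m m≤L = trans (cong (_∸ f (r (suc m))) (sym (telescope (f ∘ r ∘ suc) m (λ j<m → fall (≤-trans j<m m≤L)))))
        (m+n∸n≡m (total γ′ m + m) (f (r (suc m))))

      -- There are `total γ′ m + m` heights in this range, all at or right of position `r m`. Were
      -- they all left of `r 0`, they would have to fit into `total γ m + m` positions.
      late-value : ∀ m → 1 ≤ m → m ≤ L → total γ m < total γ′ m →
        ¬ (∀ {v} → f (r (suc m)) < v → v < suc (f (r 1)) → f⁻¹ v < r 0)
      late-value m 1≤m m≤L γ<γ′ early = <⇒≱ γ<γ′ (+-cancelʳ-≤ m _ _ (begin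
        total γ′ m + m ≡⟨ sym (length-applyUpTo h (total γ′ m + m)) ⟩
        length (applyUpTo h (total γ′ m + m)) ≤⟨ unique-length≤ uniq bounds ⟩
        r 0 ∸ r m      ≡⟨ gap m m≤L ⟩
        total γ m + m  ∎))
        where
        open ≤-Reasoning
        value : ℕ → ℕ
        value i = suc (f (r (suc m)) + i)
        h : ℕ → ℕ
        h i = f⁻¹ (value i)
        value< : ∀ {i} → i < total γ′ m + m → value i < suc (f (r 1))
        value< {i} i< = s≤s (subst (value i ≤_) (m+[n∸m]≡n (<⇒≤ (fr1 m≤L)))
          (subst (_≤ f (r (suc m)) + (f (r 1) ∸ f (r (suc m)))) (+-suc (f (r (suc m))) i)
            (+-monoʳ-≤ (f (r (suc m))) (subst (i <_) (sym (gap′ m m≤L)) i<))))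
          where
          fr1 : m ≤ L → f (r (suc m)) < f (r 1)
          fr1 m≤L with m≤n⇒m<n∨m≡n 1≤m
          ... | inj₁ 1<m  = <-trans (fall m≤L) (fr-anti m≤L 1<m)
          ... | inj₂ refl = fall m≤L
        value≤n : ∀ {i} → i < total γ′ m + m → value i ≤ n
        value≤n i< = ≤-trans (≤-pred (value< i<)) (proj₂ (F.f-range (1≤r (≤-trans 1≤m m≤L)) (bound (≤-trans 1≤m m≤L))))
        uniq : Unique (applyUpTo h (total γ′ m + m))
        uniq = Unique.applyUpTo⁺₁ h _ λ {i} {j} i<j j< eq → <⇒≢ i<j (+-cancelˡ-≡ (f (r (suc m))) i j
          (suc-injective (f⁻¹-injective (s≤s z≤n) (value≤n (<-trans i<j j<)) (s≤s z≤n) (value≤n j<) eq)))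
        bounds : All (λ x → r m ≤ x × x < r 0) (applyUpTo h (total γ′ m + m))
        bounds = All.applyUpTo⁺₁ h _ λ {i} i< →
          ≮⇒≥ (λ h<r → <⇒≱ (s≤s (m≤m+n (f (r (suc m))) i))
            (subst (_≤ f (r (suc m))) (F.f-f⁻¹ (s≤s z≤n) (value≤n i<))
              (below m≤L (proj₁ (F.f⁻¹-range (s≤s z≤n) (value≤n i<))) h<r)))
          , early (s≤s (m≤m+n _ i)) (value< i<)

      -- The search starts at the lowest step and moves up; as `y` is no corner height, it ends
      -- strictly inside a step.
      locate : ∀ {y} m → f (r (suc (suc m))) < y → y ≤ f (r 1) →
        (∀ {j} → 1 ≤ j → j ≤ suc m → y ≢ f (r j)) →
        ∃ λ s → 1 ≤ s × s ≤ suc m × f (r (suc s)) < y × y < f (r s)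
      locate zero lo hi y≢ = 1 , ≤-refl , ≤-refl , lo , ≤∧≢⇒< hi (y≢ ≤-refl ≤-refl)
      locate {y} (suc m) lo hi y≢ with <-cmp y (f (r (suc (suc m))))
      ... | tri< y< _ _ = suc (suc m) , s≤s z≤n , ≤-refl , lo , y<
      ... | tri≈ _ y≡ _ = ⊥-elim (y≢ (s≤s z≤n) ≤-refl y≡)
      ... | tri> _ _ y> with s , 1≤s , s≤ , rest ← locate m y> hi (λ 1≤j j≤ → y≢ 1≤j (m≤n⇒m≤1+n j≤))
        = s , 1≤s , m≤n⇒m≤1+n s≤ , rest

      -- `late` and `early` make `y` the largest height up to `f (r 1)` found at or right of `r 0`;
      -- `s` names its step.
      module _ {s y : ℕ} (1≤s : 1 ≤ s) (s≤L : s ≤ L) (lo : f (r (suc s)) < y) (hi : y < f (r s))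
        (late : r 0 ≤ f⁻¹ y) (early : ∀ {z} → y < z → z < suc (f (r 1)) → f⁻¹ z < r 0) where

        y<w : ∀ {j} → j < s → y < w j
        y<w j<s with m≤n⇒m<n∨m≡n j<s
        ... | inj₁ 1+j<s = <-trans hi (m<n⇒m<1+n (fr-anti s≤L 1+j<s))
        ... | inj₂ refl  = m<n⇒m<1+n hi

        1≤y : 1 ≤ y
        1≤y = ≤-trans (s≤s z≤n) lo

        w≤fr0 : ∀ {j} → j < s → w j ≤ f (r 0)
        w≤fr0 j<s = fr-anti (≤-trans j<s s≤L) (s≤s z≤n)

        fr0≤n : f (r 0) ≤ n
        fr0≤n = proj₂ (F.f-range (1≤r z≤n) (bound z≤n))

        -- A hook from v ≤ y to w j would force y before w j in π, and then r 0, y, w j form the pattern 312.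
        source-above : ∀ {j v} → j < s → Source j v → y < v
        source-above {j} {v} j<s src = ≰⇒> λ v≤y → contra (y-first v≤y)
          where
          open Source src
          wj≤n : w j ≤ n
          wj≤n = ≤-trans (w≤fr0 j<s) fr0≤n
          y≤n : y ≤ n
          y≤n = ≤-trans (<⇒≤ (y<w j<s)) wj≤n
          y-first : v ≤ y → f⁻¹ y < f⁻¹ (w j)
          y-first v≤y with m≤n⇒m<n∨m≡n v≤y
          ... | inj₁ v<y  = proj₂ (order⁻ 1≤v v<w wj≤n before) v<y (y<w j<s)
          ... | inj₂ refl = proj₁ (order⁻ 1≤v v<w wj≤n before)
          contra : ¬ f⁻¹ y < f⁻¹ (w j)
          contra y<wj = av312 (r 0) (f⁻¹ y) (f⁻¹ (w j)) (1≤r z≤n)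
            (≤∧≢⇒< late λ eq → <⇒≢ (<-≤-trans (y<w j<s) (w≤fr0 j<s))
              (trans (sym (F.f-f⁻¹ 1≤y y≤n)) (cong f (sym eq))))
            y<wj (proj₂ (F.f⁻¹-range (s≤s z≤n) wj≤n))
            ( subst₂ _<_ (sym (F.f-f⁻¹ 1≤y y≤n)) (sym (F.f-f⁻¹ (s≤s z≤n) wj≤n)) (y<w j<s)
            , subst (_< f (r 0)) (sym (F.f-f⁻¹ (s≤s z≤n) wj≤n))
                (≤∧≢⇒< (w≤fr0 j<s) λ eq → <⇒≱ y<wj
                  (≤-trans (≤-reflexive (trans (cong f⁻¹ eq) (f⁻¹-r z≤n))) late)) )

        marked-bounds : ∀ {j x} → j < s → Marked j x → r s ≤ x × x < r 0
        marked-bounds j<s (inj₁ refl) = r≥ (m≤n⇒m<n∨m≡n j<s) , r-anti (≤-trans j<s s≤L) (s≤s z≤n)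
          where
          r≥ : ∀ {i} → i < s ⊎ i ≡ s → r s ≤ r i
          r≥ (inj₁ i<s)  = <⇒≤ (r-anti s≤L i<s)
          r≥ (inj₂ refl) = ≤-refl
        marked-bounds {j} j<s (inj₂ (v , h , refl)) =
          -- Left of `r s` nothing exceeds `f (r (suc s))`, which is below `y` and hence below `v`.
          m≤n⇒m≤1+n (≮⇒≥ λ p<r → <⇒≱ (<-trans lo (source-above j<s src))
            (subst (_≤ f (r (suc s))) (F.f-f⁻¹ 1≤v v≤n) (below s≤L (proj₁ (F.f⁻¹-range 1≤v v≤n)) p<r)))
          -- `early` puts `v` left of `r 0`; the next position could still be `r 0`, but a descent
          -- bottom is no corner.
          , ≤∧≢⇒< (early (source-above j<s src) (<-≤-trans v<w (s≤s (f≤ j j<s)))) (r-bottom≢ z≤n src)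
          where
          src : Source j v
          src = source h
          open Source src
          f≤ : ∀ i → i < s → f (r (suc i)) ≤ f (r 1)
          f≤ zero    _     = ≤-refl
          f≤ (suc i) 1+i<s = <⇒≤ (fr-anti (≤-trans 1+i<s s≤L) (s≤s (s≤s z≤n)))

        -- The first `s` blocks mark `s + count B s` distinct positions, all in the interval from
        -- `r s` up to but excluding `r 0`, which has `s + total γ s` positions.
        enough : count B s ≤ total γ s
        enough with xs , len , u , marks ← marked-list s s≤L = +-cancelˡ-≤ s _ _ (begin
          s + count B s ≡⟨ sym len ⟩
          length xs     ≤⟨ unique-length≤ u (All.map (λ (j , j<s , m) → marked-bounds j<s m) marks) ⟩
          r 0 ∸ r s     ≡⟨ gap s s≤L ⟩
          total γ s + s ≡⟨ +-comm (total γ s) s ⟩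
          s + total γ s ∎)
          where open ≤-Reasoning

    -- If `P` is not balanced after `m` blocks, then `total γ m < count B m ≤ total γ′ m`, the
    -- strict inequality that `late-value` turns into a late height.
    early-balance : ∀ m → 1 ≤ m → m ≤ L → count B m ≤ total γ′ m →
      ∃ λ s → 1 ≤ s × s ≤ m × count B s ≤ total γ s
    early-balance m@(suc m′) 1≤m m≤L cnt with count B m ≤? total γ m
    ... | yes cnt′ = m , 1≤m , ≤-refl , cnt′
    ... | no cnt≰ with late-value m 1≤m m≤L (<-≤-trans (≰⇒> cnt≰) cnt) | largest-below (λ v → r 0 ≤? f⁻¹ v) (suc (f (r 1)))
    ...   | not-early | inj₂ none = ⊥-elim (not-early λ _ v< → ≰⇒> (none v<))
    ...   | not-early | inj₁ (y , y< , late , above) with f (r (suc m)) <? y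
    ...     | no ≮y = ⊥-elim (not-early λ fr<v v< → ≰⇒> (above (≤-<-trans (≮⇒≥ ≮y) fr<v) v<))
    ...     | yes lo
      -- The corners `r 1, …, r m` lie left of `r 0` and `y` does not, so `y` is none of their
      -- heights.
      with s , 1≤s , s≤m , lo′ , hi′ ← locate m′ lo (≤-pred y<) (λ 1≤j j≤m y≡ →
             <⇒≱ (r-anti (≤-trans j≤m m≤L) 1≤j)
               (≤-trans late (≤-reflexive (trans (cong f⁻¹ y≡) (f⁻¹-r (≤-trans j≤m m≤L))))))
      = s , 1≤s , s≤m , enough 1≤s (≤-trans s≤m m≤L) lo′ hi′ late (λ y<z z< → ≰⇒> (above y<z z<))

-- Left-to-right maxima and hooks

-- Reading past the end gives 0, the position of the sentinel to the left of all maxima; by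
-- `at-zero` its height is 0 as well.
nth : List ℕ → ℕ → ℕ
nth []       _       = 0
nth (x ∷ xs) zero    = x
nth (x ∷ xs) (suc j) = nth xs j

at-zero : ∀ xs → at xs 0 ≡ 0
at-zero []       = refl
at-zero (x ∷ xs) = refl

buildP-word : ∀ V prev rs → let R = nth (prev ∷ rs) in
  buildP V prev rs ≡ word (λ j → elemB (R j) V) (λ j → R j ∸ R (suc j) ∸ 1) (length rs)
buildP-word V prev []       = refl
buildP-word V prev (r ∷ rs) = cong (λ w → Xof V prev ∷ (replicate (prev ∸ r ∸ 1) D ++ w)) (buildP-word V r rs)

buildQ-word : ∀ π V prev rs → let R = nth (prev ∷ rs) in
  buildQ π V prev rs ≡
  word (λ j → elemB (R j) V) (λ j → at π (R (suc j)) ∸ at π (R (suc (suc j))) ∸ 1) (length rs)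
buildQ-word π V prev []            = refl
buildQ-word π V prev (r ∷ [])      rewrite at-zero π = cong (Xof V prev ∷_) (sym (++-identityʳ _))
buildQ-word π V prev (r ∷ r′ ∷ rs) =
  cong (λ w → Xof V prev ∷ (replicate (at π r ∸ at π r′ ∸ 1) D ++ w)) (buildQ-word π V r (r′ ∷ rs))

-- rs lists, from right to left, the left-to-right maxima among the positions below k.
record Maxima (f : ℕ → ℕ) (k : ℕ) (rs : List ℕ) : Set where
  field
    top   : ∀ {p} → 1 ≤ p → p < k → f p ≤ f (nth rs 0)
    bound : ∀ {j} → j < length rs → nth rs j < k
    drop  : ∀ {j} → j < length rs → nth rs (suc j) < nth rs j
    fall  : ∀ {j} → j < length rs → f (nth rs (suc j)) < f (nth rs j)
    below : ∀ {j p} → j < length rs → 1 ≤ p → p < nth rs j → f p ≤ f (nth rs (suc j))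

module _ {f : ℕ → ℕ} {k : ℕ} {rs : List ℕ} (1≤k : 1 ≤ k) (M : Maxima f k rs) where
  open Maxima M

  Maxima-skip : f k ≤ f (nth rs 0) → Maxima f (suc k) rs
  Maxima-skip fk≤ = record
    { top   = λ 1≤p p<1+k → top′ 1≤p (m≤n⇒m<n∨m≡n (≤-pred p<1+k))
    ; bound = m<n⇒m<1+n ∘ bound
    ; drop  = drop
    ; fall  = fall
    ; below = below
    }
    where
    top′ : ∀ {p} → 1 ≤ p → p < k ⊎ p ≡ k → f p ≤ f (nth rs 0)
    top′ 1≤p (inj₁ p<k)  = top 1≤p p<k
    top′ 1≤p (inj₂ refl) = fk≤

  Maxima-extend : f (nth rs 0) < f k → Maxima f (suc k) (k ∷ rs)
  Maxima-extend <fk = record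
    { top   = λ 1≤p p<1+k → top′ 1≤p (m≤n⇒m<n∨m≡n (≤-pred p<1+k))
    ; bound = λ { {zero} _ → ≤-refl ; {suc j} (s≤s j<) → m<n⇒m<1+n (bound j<) }
    ; drop  = λ { {zero} _ → head<k rs refl ; {suc j} (s≤s j<) → drop j< }
    ; fall  = λ { {zero} _ → <fk ; {suc j} (s≤s j<) → fall j< }
    ; below = λ { {zero} _ → top ; {suc j} (s≤s j<) → below j< }
    }
    where
    top′ : ∀ {p} → 1 ≤ p → p < k ⊎ p ≡ k → f p ≤ f k
    top′ 1≤p (inj₁ p<k)  = <⇒≤ (≤-<-trans (top 1≤p p<k) <fk)
    top′ 1≤p (inj₂ refl) = ≤-refl
    head<k : ∀ rs′ → rs ≡ rs′ → nth rs′ 0 < k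
    -- With no maximum found so far the previous corner is the sentinel 0.
    head<k []      _    = 1≤k
    head<k (_ ∷ _) refl = bound (s≤s z≤n)

-- `acc` holds the maxima already found, latest first, so the running maximum of `lrGo` is the
-- height of its head; the `foldl` is the one to which `reverse` unfolds.
lrGo-Maxima : ∀ {f} xs i acc → 1 ≤ i → (∀ {t} → t < length xs → f (t + i) ≡ at xs (suc t)) →
  Maxima f i acc → Maxima f (length xs + i) (foldl (flip _∷_) acc (lrGo (f (nth acc 0)) i xs))
lrGo-Maxima []       i acc 1≤i link M = M
lrGo-Maxima {f} (x ∷ xs) i acc 1≤i link M
  with refl ← link {0} (s≤s z≤n)
  with f (nth acc 0) <ᵇ f i in lt
... | true = subst (λ l → Maxima f l (foldl (flip _∷_) (i ∷ acc) (lrGo (f i) (suc i) xs))) (+-suc (length xs) i)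
  (lrGo-Maxima xs (suc i) (i ∷ acc) (s≤s z≤n) (λ {t} t< → trans (cong f (+-suc t i)) (link (s≤s t<)))
    (Maxima-extend 1≤i M (<ᵇ⇒< _ _ (subst T (sym lt) tt))))
... | false = subst (λ l → Maxima f l (foldl (flip _∷_) acc (lrGo (f (nth acc 0)) (suc i) xs))) (+-suc (length xs) i)
  (lrGo-Maxima xs (suc i) acc (s≤s z≤n) (λ {t} t< → trans (cong f (+-suc t i)) (link (s≤s t<)))
    (Maxima-skip 1≤i M (≮⇒≥ λ fk → subst T lt (<⇒<ᵇ fk))))

lrMaxima-Maxima : ∀ π → Maxima (at π) (suc (length π)) (reverse (lrMaxima π))
lrMaxima-Maxima π = subst₂ (λ m k → Maxima (at π) k (reverse (lrGo m 1 π))) (at-zero π) (+-comm (length π) 1)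
  (lrGo-Maxima π 1 [] ≤-refl (λ {t} _ → cong (at π) (+-comm t 1)) record
    { top   = λ { (s≤s _) (s≤s ()) }
    ; bound = λ ()
    ; drop  = λ ()
    ; fall  = λ ()
    ; below = λ ()
    })

elemB-∈ : ∀ a xs → elemB a xs ≡ true → a ∈ xs
elemB-∈ a (x ∷ xs) eq with a ≡ᵇ x in a≡x
... | true  = here (≡ᵇ⇒≡ a x (subst T (sym a≡x) tt))
... | false = there (elemB-∈ a xs eq)

total-cong : ∀ {γ γ′} → (∀ j → γ j ≡ γ′ j) → ∀ m → total γ m ≡ total γ′ m
total-cong eq zero    = refl
total-cong eq (suc m) = cong₂ _+_ (eq 0) (total-cong (eq ∘ suc) m)

-- Two hooks sharing their southwest endpoint overlap just above it, at a half-integer height.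
southwest-unique : ∀ {σ H} → IsVHC σ H → ∀ {a b b′} → (a , b) ∈ H → (a , b′) ∈ H → b ≡ b′
southwest-unique {σ} vhc {a} {b} {b′} h h′ with b ≟ b′
... | yes b≡b′ = b≡b′
... | no  b≢b′ = ⊥-elim (not-endpoint (proj₁ (meet-ends _ _ h h′ (λ { refl → b≢b′ refl }) (2 * a , suc (2 * at σ a))
                   (on h) (on h′))))
  where
  open IsVHC vhc
  on : ∀ {c} → (a , c) ∈ _ → OnHook σ (a , c) (2 * a , suc (2 * at σ a))
  on hc with _ , _ , _ , σa<σc ← hook-wf _ _ hc = inj₁ (refl , n≤1+n _ , *-monoʳ-< 2 σa<σc)
  not-endpoint : ¬ IsEndpoint σ (a , b) (2 * a , suc (2 * at σ a))
  not-endpoint (inj₁ (_ , y≡)) = 1+n≢n y≡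
  not-endpoint (inj₂ (x≡ , _)) = <⇒≢ (proj₁ (proj₂ (hook-wf _ _ h))) (*-cancelˡ-≡ a b 2 x≡)

-- From configurations on `swr π` to the comparison of `P` and `Q`

module _ {n : ℕ} {π : List ℕ} (perm : IsPerm n π) (av312 : Av312 π) where
  private
    module P = Inverse (at-inverse perm)
    module S = Inverse (at-inverse (swr-perm perm))
    module M = Maxima (lrMaxima-Maxima π)
    R : ℕ → ℕ
    R = nth (reverse (lrMaxima π))
    ℓ : ℕ
    ℓ = length (reverse (lrMaxima π))
    length-swr : length (swr π) ≡ n
    length-swr = length-perm (swr-perm perm)

    R≤length : ∀ {j} → j < ℓ → R j ≤ length π
    R≤length j<ℓ = ≤-pred (M.bound j<ℓ)

    R-LRMax : ∀ {j} → j < ℓ → LRMax π (R j)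
    R-LRMax j<ℓ = (≤-trans (s≤s z≤n) (M.drop j<ℓ) , R≤length j<ℓ) ,
      λ p 1≤p p<R → ≤-<-trans (M.below j<ℓ 1≤p p<R) (M.fall j<ℓ)

    height-injective : ∀ {p q} → InRange π p → InRange π q → at π p ≡ at π q → p ≡ q
    height-injective (1≤p , p≤) (1≤q , q≤) eq = trans (sym (P.f⁻¹-f 1≤p (subst (_ ≤_) (length-perm perm) p≤)))
      (trans (cong (index π) eq) (P.f⁻¹-f 1≤q (subst (_ ≤_) (length-perm perm) q≤)))

  -- Nothing left of `R j` reaches the height of `q`, so `nw` sends `q` to `R j`. A later point with
  -- the same image cannot be lower, as `R (suc j)` would then be a candidate further left, nor
  -- higher, as `R j`, `q` and it would form 312.
  nw-inverse : ∀ {j q} → suc j < ℓ → InRange π q → at π q ≡ suc (at π (R (suc j))) → IsNwInv π (R j) q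
  nw-inverse {j} {q} 1+j<ℓ q-in q≡ = (q-in , R-LRMax j<ℓ , R≤q , q≤top , leftmost) , rightmost
    where
    j<ℓ : j < ℓ
    j<ℓ = <⇒≤ 1+j<ℓ
    right-of-R : ∀ {p} → 1 ≤ p → at π q ≤ at π p → R j ≤ p
    right-of-R 1≤p q≤p = ≮⇒≥ λ p<R → <⇒≱ (≤-trans (≤-reflexive (sym q≡)) q≤p) (M.below j<ℓ 1≤p p<R)
    R≤q : R j ≤ q
    R≤q = right-of-R (proj₁ q-in) ≤-refl
    q≤top : at π q ≤ at π (R j)
    q≤top = ≤-trans (≤-reflexive q≡) (M.fall j<ℓ)
    leftmost : ∀ j′ → LRMax π j′ → j′ ≤ q → at π q ≤ at π j′ → R j ≤ j′
    leftmost j′ ((1≤j′ , _) , _) _ q≤j′ = right-of-R 1≤j′ q≤j′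
    rightmost : ∀ q′ → q < q′ → q′ ≤ length π → ¬ IsNw π q′ (R j)
    rightmost q′ q<q′ q′≤ (q′-in , _ , R≤q′ , q′≤top , leftmost′) with <-cmp (at π q′) (at π q)
    ... | tri≈ _ eq _ = <⇒≢ q<q′ (sym (height-injective q′-in q-in eq))
    ... | tri< q′<q _ _ = <⇒≱ (M.drop j<ℓ) (leftmost′ (R (suc j)) (R-LRMax 1+j<ℓ)
            (≤-trans (<⇒≤ (M.drop j<ℓ)) R≤q′) (≤-pred (≤-trans q′<q (≤-reflexive q≡))))
    ... | tri> _ _ q<q′-height = av312 (R j) q q′ (proj₁ (proj₁ (R-LRMax j<ℓ)))
            (≤∧≢⇒< R≤q λ eq → <⇒≱ q<q′-height (subst (λ i → at π q′ ≤ at π i) eq q′≤top))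
            q<q′ q′≤
            (q<q′-height , ≤∧≢⇒< q′≤top λ eq → <⇒≢ (≤-<-trans R≤q q<q′)
              (height-injective (proj₁ (R-LRMax j<ℓ)) q′-in (sym eq)))

  module _ {V : List ℕ} {H : List Hook} (vhc : IsVHC (swr π) H) (ends : NEEndpointsAre H (InW π V)) where
    open IsVHC vhc
    private
      -- Hooks are recorded by heights, since a point keeps its height under `swr` while its
      -- position changes.
      Hooked : ℕ → ℕ → Set
      Hooked x w = ∃ λ a → ∃ λ b → (a , b) ∈ H × x ≡ at (swr π) a × w ≡ at (swr π) b

      index-swr : ∀ {a} → 1 ≤ a → a ≤ length (swr π) → index (swr π) (at (swr π) a) ≡ a
      index-swr 1≤a a≤ = S.f⁻¹-f 1≤a (subst (_ ≤_) length-swr a≤)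

    hooked-below : ∀ {x w} → Hooked x w → x < w × index (swr π) x < index (swr π) w
    hooked-below (a , b , h , refl , refl) with 1≤a , a<b , b≤ , lt ← hook-wf a b h =
      lt , subst₂ _<_ (sym (index-swr 1≤a (≤-trans (<⇒≤ a<b) b≤))) (sym (index-swr (≤-trans 1≤a (<⇒≤ a<b)) b≤)) a<b

    hooked-descent : ∀ {x w} → Hooked x w →
      ∃ λ a → 1 ≤ a × a < n × x ≡ at (swr π) a × at (swr π) (suc a) < at (swr π) a
    hooked-descent (a , b , h , x≡ , _) with 1≤a , a< , desc ← descent-sw a b h =
      a , 1≤a , subst (a <_) length-swr a< , x≡ , desc

    hooked-unique : ∀ {x w w′} → Hooked x w → Hooked x w′ → w ≡ w′
    hooked-unique (a , b , h , refl , refl) (a′ , b′ , h′ , eq , refl)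
      with 1≤a , a<b , b≤ , _ ← hook-wf a b h | 1≤a′ , a′<b′ , b′≤ , _ ← hook-wf a′ b′ h′
      with refl ← trans (sym (index-swr 1≤a (≤-trans (<⇒≤ a<b) b≤)))
                    (trans (cong (index (swr π)) eq) (index-swr 1≤a′ (≤-trans (<⇒≤ a′<b′) b′≤)))
      = cong (at (swr π)) (southwest-unique vhc h h′)

    -- By `nw-inverse` the point of this height in `swr π` belongs to `W`, so some hook ends there.
    hooked : ∀ {j} → suc j < ℓ → elemB (R j) V ≡ true → ∃ λ x → Hooked x (suc (at π (R (suc j))))
    hooked {j} 1+j<ℓ R∈V
      with 1≤R , R≤ ← proj₁ (R-LRMax (<⇒≤ 1+j<ℓ))
      with _ , R-height ← P.f-range 1≤R (subst (_ ≤_) (length-perm perm) R≤)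
      with v≤n ← ≤-trans (M.fall (<⇒≤ 1+j<ℓ)) R-height
      with 1≤q , q≤n ← P.f⁻¹-range (s≤s z≤n) v≤n | 1≤b , b≤n ← S.f⁻¹-range (s≤s z≤n) v≤n
      with q≡ ← P.f-f⁻¹ (s≤s z≤n) v≤n | b≡ ← S.f-f⁻¹ (s≤s z≤n) v≤n
      with q-in ← (1≤q , subst (_ ≤_) (sym (length-perm perm)) q≤n)
      with (a , b) , h , refl ← ∈-map⁻ proj₂ (proj₂ (ends _)
        (R j , elemB-∈ (R j) V R∈V , _ , nw-inverse 1+j<ℓ q-in q≡ ,
         (1≤b , subst (_ ≤_) (sym length-swr) b≤n) , trans b≡ (sym q≡)))
      = at (swr π) a , a , b , h , refl , sym b≡

    -- The contrapositive of the theorem: a configuration on `swr π` with northeast endpoints `W`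
    -- forces the comparison.
    Λ-≤T : ΛP π V ≤T ΛQ π V
    Λ-≤T with reverse (lrMaxima π) | lrMaxima-Maxima π | (λ {j} → hooked {j})
    ... | []      | _ | _ = refl , λ i l l′ → λ { (_ , () , _) _ }
    ... | r₀ ∷ rs | M | hooked =
      subst₂ _≤T_ (sym (buildP-word V r₀ rs)) (sym (buildQ-word π V r₀ rs))
        (≤T-words B _ _ (length rs) core)
      where
      open Maxima M
      R′ : ℕ → ℕ
      R′ = nth (r₀ ∷ rs)
      B : ℕ → Bool
      B j = elemB (R′ j) V
      core : ∀ k m → k < length rs → m ≤ length rs ∸ k → 1 ≤ m →
        count (B ∘ (k +_)) m ≤ total (λ j → at π (R′ (suc (k + j))) ∸ at π (R′ (suc (suc (k + j)))) ∸ 1) m →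
        ∃ λ s → 1 ≤ s × s ≤ m × count (B ∘ (k +_)) s ≤ total (λ j → R′ (k + j) ∸ R′ (suc (k + j)) ∸ 1) s
      -- Discarding the first `k` maxima leaves a staircase starting at `R′ k`, whose blocks form
      -- the suffixes of `P` and `Q` compared here.
      core k m k< m≤ 1≤m cnt = map₂
        (λ {s} → map₂ (map₂ (subst (count (B ∘ (k +_)) s ≤_) (sym (total-cong γ≡ s)))))
        (early-balance (at-inverse perm) (at-inverse (swr-perm perm))
          (λ a b c 1≤a a<b b<c c≤n → av312 a b c 1≤a a<b b<c (subst (c ≤_) (sym (length-perm perm)) c≤n))
          (swr-index⁻ perm) (swr-index⁺ perm) Hooked hooked-below hooked-descent hooked-unique
          stairs (B ∘ (k +_))
          (λ {j} j< → subst (λ i → B (k + j) ≡ true → ∃ λ x → Hooked x (suc (at π (R′ i)))) (sym (+-suc k j)) (hooked (s≤s (subst (_≤ length rs) (+-suc k j) (fits j<)))))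
          m 1≤m m≤ (subst (count (B ∘ (k +_)) m ≤_) (total-cong γ′≡ m) cnt))
        where
        fits : ∀ {j} → j ≤ length rs ∸ k → k + j ≤ length rs
        fits j≤ = ≤-trans (+-monoʳ-≤ k j≤) (≤-reflexive (m+[n∸m]≡n (<⇒≤ k<)))
        stairs : Staircase n (at π) (R′ ∘ (k +_)) (length rs ∸ k)
        stairs = record
          { bound = λ j≤ → ≤-trans (≤-pred (bound (s≤s (fits j≤)))) (≤-reflexive (length-perm perm))
          ; drop  = λ {j} j≤ → subst (λ i → R′ i < R′ (k + j)) (sym (+-suc k j)) (drop (s≤s (fits j≤)))
          ; fall  = λ {j} j≤ → subst (λ i → at π (R′ i) < at π (R′ (k + j))) (sym (+-suc k j)) (fall (s≤s (fits j≤)))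
          ; below = λ {j} {p} j≤ 1≤p p< → subst (λ i → at π p ≤ at π (R′ i)) (sym (+-suc k j)) (below (s≤s (fits j≤)) 1≤p p<)
          }
        γ≡ : ∀ j → R′ (k + j) ∸ R′ (suc (k + j)) ∸ 1 ≡ R′ (k + j) ∸ R′ (k + suc j) ∸ 1
        γ≡ j = cong (λ i → R′ (k + j) ∸ R′ i ∸ 1) (sym (+-suc k j))
        γ′≡ : ∀ j → at π (R′ (suc (k + j))) ∸ at π (R′ (suc (suc (k + j)))) ∸ 1 ≡
                    at π (R′ (k + suc j)) ∸ at π (R′ (k + suc (suc j))) ∸ 1
        γ′≡ j rewrite +-suc k (suc j) | +-suc k j = refl

theorem7p2 : ∀ (n : ℕ) (π V : List ℕ) →
    IsPerm n π → Av312 π → HasVHC π V →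
    ¬ (ΛP π V ≤T ΛQ π V) →
    ¬ (Σ (List Hook) λ H → IsVHC (swr π) H × NEEndpointsAre H (InW π V))
theorem7p2 n π V perm av312 _ P≰Q (H , vhc , ends) = P≰Q (Λ-≤T perm av312 vhc ends)
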